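{- Let $\Delta\ge2$ be an integer and $\Lambda$ a real constant. Let $G=(V,E,w)$ be a weighted tree with $|V|=n\ge2$, weights $w:E\to\mathbb{R}_{>0}$, and maximum degree at most $\Delta$. Suppose that for every $S\subseteq V$ with $G[S]$ connected and $|S|\ge2$ there is an edge $e_S\in E(G[S])$ whose removal from the tree $G[S]$ produces components $A$ and $B$ (vertex sets) satisfying $$\max\{|A|-1,|B|-1\}\le\left(1-\frac1\Delta\right)(|S|-1)$$ and which also satisfies $$w_{e_S}\le\Lambda\,\frac{W(S)}{|S|-1}.$$ Then $$\frac{\operatorname{OPT}_{\mathrm{card}}(G,w)}{\operatorname{OPT}_{\mathrm{free}}(G,w)}\le\Lambda\left(1+\left\lfloor\log_{\Delta/(\Delta-1)}(n-1)\right\rfloor\right).$$ In particular, for a weighted tree $G$ of maximum degree at most $\Delta$, this bound holds if $$\frac{\max_{e\in E}w_e}{\min_{e\in E}w_e}\le\Lambda.$$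
   Context: $W(S)=\sum_{xy\in E(G[S])}w_{xy}$. $d_G$ is the shortest-path metric of $(V,E)$ with every edge of length $1$ (weights are not lengths). $\operatorname{OPT}_{\mathrm{free}}(G,w)$ is the minimum of $\sum_{xy\in E}w_{xy}u(x,y)$ over all ultrametrics $u$ on $V$ (metrics with $u(x,y)\le\max\{u(x,z),u(z,y)\}$) with $u\ge d_G$ on all pairs. A rooted binary hierarchy $H$ on $V$ is a rooted tree whose leaves are the vertices of $V$ and whose internal nodes have exactly two children; $C_H(x,y)$ is the set of leaves below the lowest common ancestor of $x,y$; $h_H(x,x)=0$ and $h_H(x,y)=|C_H(x,y)|-1$ for $x\ne y$. $\operatorname{OPT}_{\mathrm{card}}(G,w)$ is the minimum of $\sum_{xy\in E}w_{xy}h_H(x,y)$ over all rooted binary hierarchies $H$ on $V$ with $h_H\ge d_G$ on all pairs. -}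

module Defs where

open import Algebra.Bundles using (CommutativeRing)
import Algebra.Definitions.RawMonoid as RawMonoid
import Algebra.Properties.Semiring.Exp as Exp
open import Data.Bool.Base using (if_then_else_)
open import Data.Fin.Base using (Fin)
open import Data.Fin.Properties using (_≟_; _<?_)
open import Data.Fin.Subset using (Subset; _∈_; ∣_∣)
open import Data.Fin.Subset.Properties using (_∈?_)
open import Data.Integer.Base using (+_)
open import Data.List.Base using (List; []; _∷_; _++_; length; allFin)
import Data.List.Membership.DecPropositional as ListMembership
open import Data.List.Relation.Binary.Permutation.Propositional using (_↭_)
open import Data.List.Relation.Unary.Linked using (Linked)
open import Data.List.Relation.Unary.Unique.Propositional using (Unique)
import Data.Nat.Base as ℕ
open import Data.Nat.Base using (ℕ; zero; suc; NonZero; _∸_)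
open import Data.Product.Base using (Σ-syntax; ∃; ∃₂; ∃-syntax; _×_; _,_; proj₁; proj₂)
open import Data.Rational.Base using (ℚ; 1ℚ; _/_)
import Data.Rational.Base as ℚ
import Data.Rational.Properties as ℚ
open import Data.Sum.Base using (_⊎_; inj₂)
open import Data.Vec.Base using (tabulate)
open import Function.Bundles using (_⇔_)
open import Level using (Level; 0ℓ; _⊔_) renaming (suc to lsuc)
open import Relation.Binary.Construct.Closure.ReflexiveTransitive using (Star; fold)
open import Relation.Binary.Core using (Rel)
open import Relation.Binary.Definitions using (Decidable; Cotransitive)
open import Relation.Binary.Lattice.Structures using (IsLattice)
open import Relation.Binary.PropositionalEquality.Core using (_≡_)
open import Relation.Binary.Structures using (IsStrictPartialOrder)
open import Relation.Nullary using (¬_)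
open import Relation.Nullary.Decidable using (does; _×-dec_)

-- The real numbers, axiomatised as a Cauchy complete Archimedean ordered
-- field.  Classically ℝ is the only model up to isomorphism; the order axioms
-- are phrased so that constructive reals are models too (hence cotransitivity
-- instead of trichotomy, and x ≤ y as ¬ (y < x)).

record Reals c ℓ₁ ℓ₂ : Set (lsuc (c ⊔ ℓ₁ ⊔ ℓ₂)) where
  infix  4 _<_ _≤_ _#_
  infixl 6 _∨_ _∧_
  infix  8 _⁻¹⟨_⟩
  infix  7 _÷_⟨_⟩

  field
    commutativeRing : CommutativeRing c ℓ₁

  open CommutativeRing commutativeRing public

  field
    _<_ : Rel Carrier ℓ₂

  _≤_ : Rel Carrier ℓ₂
  x ≤ y = ¬ (y < x)

  _#_ : Rel Carrier ℓ₂
  x # y = (x < y) ⊎ (y < x)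

  fromℕ : ℕ → Carrier
  fromℕ n = RawMonoid._×_ +-rawMonoid n 1#

  field
    <-isStrictPartialOrder : IsStrictPartialOrder _≈_ _<_
    <-cotransitive         : Cotransitive _<_
    _∨_ _∧_                : Carrier → Carrier → Carrier
    ≤-isLattice            : IsLattice _≈_ _≤_ _∨_ _∧_
    0<1                    : 0# < 1#
    +-monoʳ-<              : ∀ z {x y} → x < y → z + x < z + y
    *-pos                  : ∀ {x y} → 0# < x → 0# < y → 0# < x * y
    _⁻¹⟨_⟩                 : ∀ x → x # 0# → Carrier
    ⁻¹-inverseʳ            : ∀ x (nz : x # 0#) → x * x ⁻¹⟨ nz ⟩ ≈ 1#
    archimedean            : ∀ x → ∃[ n ] x < fromℕ n
    -- An inequality (k + 1) (x − y) < 1 stands for x − y < 1 / (k + 1).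
    complete : (s : ℕ → Carrier) →
      (∀ k → ∃[ N ] ∀ m n → N ℕ.≤ m → N ℕ.≤ n →
        fromℕ (suc k) * (s m - s n) < 1#) →
      ∃[ L ] ∀ k → ∃[ N ] ∀ n → N ℕ.≤ n →
        (fromℕ (suc k) * (s n - L) < 1#) × (fromℕ (suc k) * (L - s n) < 1#)

  module <-SPO = IsStrictPartialOrder <-isStrictPartialOrder

  fromℕ-suc-pos : ∀ n → 0# < fromℕ (suc n)
  fromℕ-suc-pos zero    = <-SPO.<-respʳ-≈ (sym (+-identityʳ 1#)) 0<1
  fromℕ-suc-pos (suc n) =
    <-SPO.trans (<-SPO.<-respʳ-≈ (sym (+-identityʳ 1#)) 0<1)
                (+-monoʳ-< 1# (fromℕ-suc-pos n))

  fromℕ#0 : ∀ n → .{{NonZero n}} → fromℕ n # 0#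
  fromℕ#0 (suc n) = inj₂ (fromℕ-suc-pos n)

  _÷_⟨_⟩ : ∀ x y → y # 0# → Carrier
  x ÷ y ⟨ nz ⟩ = x * y ⁻¹⟨ nz ⟩

  _÷ℕ_ : Carrier → (n : ℕ) → .{{NonZero n}} → Carrier
  x ÷ℕ n = x ÷ fromℕ n ⟨ fromℕ#0 n ⟩

  -- The assertion x / y ≤ z, including that the quotient is defined.
  QuotientAtMost : (x y z : Carrier) → Set ℓ₂
  QuotientAtMost x y z = Σ[ nz ∈ y # 0# ] x ÷ y ⟨ nz ⟩ ≤ z

  IsMinimum : ∀ {i p} {I : Set i} (P : I → Set p) (f : I → Carrier) →
              Carrier → Set (i ⊔ p ⊔ ℓ₁ ⊔ ℓ₂)
  IsMinimum P f m = (∃[ i ] P i × f i ≈ m) × (∀ i → P i → m ≤ f i)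

  IsMaximum : ∀ {i p} {I : Set i} (P : I → Set p) (f : I → Carrier) →
              Carrier → Set (i ⊔ p ⊔ ℓ₁ ⊔ ℓ₂)
  IsMaximum P f m = (∃[ i ] P i × f i ≈ m) × (∀ i → P i → f i ≤ m)

  sum : ∀ {n} → (Fin n → Carrier) → Carrier
  sum = RawMonoid.sum +-rawMonoid

walkLength : ∀ {V : Set} {R : Rel V 0ℓ} {x y} → Star R x y → ℕ
walkLength = fold (λ _ _ → ℕ) (λ _ → suc) 0

record Graph (n : ℕ) : Set₁ where
  infix 4 _~_ _~?_
  field
    _~_      : Rel (Fin n) 0ℓ
    _~?_     : Decidable _~_
    ~-sym    : ∀ {x y} → x ~ y → y ~ x
    ~-irrefl : ∀ {x} → ¬ (x ~ x)

  degree : Fin n → ℕ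
  degree x = ∣ tabulate (λ y → does (x ~? y)) ∣

  Induced : Subset n → Rel (Fin n) 0ℓ
  Induced S x y = x ∈ S × y ∈ S × x ~ y

  induced? : ∀ S → Decidable (Induced S)
  induced? S x y = x ∈? S ×-dec y ∈? S ×-dec x ~? y

  InducedConnected : Subset n → Set
  InducedConnected S = ∀ x y → x ∈ S → y ∈ S → Star (Induced S) x y

  Connected : Set
  Connected = ∀ x y → Star _~_ x y

  -- A cycle is a repetition-free list of at least three vertices, consecutive
  -- ones adjacent, whose last vertex is adjacent to its first.
  Acyclic : Set
  Acyclic = ∀ x y zs z →
    let vs = x ∷ y ∷ zs ++ z ∷ [] in
    Unique vs → Linked _~_ vs → ¬ (z ~ x)

  IsTree : Set
  IsTree = Connected × Acyclic

  -- d is the shortest-path distance between x and y.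
  IsDistance : Fin n → Fin n → ℕ → Set
  IsDistance x y d =
    (Σ[ p ∈ Star _~_ x y ] walkLength p ≡ d) ×
    (∀ (p : Star _~_ x y) → d ℕ.≤ walkLength p)

RemoveEdge : ∀ {n} → Rel (Fin n) 0ℓ → (a b : Fin n) → Rel (Fin n) 0ℓ
RemoveEdge R a b x y = R x y × ¬ ((x ≡ a × y ≡ b) ⊎ (x ≡ b × y ≡ a))

IsComponentOf : ∀ {n} → Rel (Fin n) 0ℓ → Fin n → Subset n → Set
IsComponentOf R a C = ∀ x → x ∈ C ⇔ Star R a x

2≤⇒nonZero : ∀ {m} → 2 ℕ.≤ m → NonZero m
2≤⇒nonZero (ℕ.s≤s _) = _

2≤⇒pred-nonZero : ∀ {m} → 2 ℕ.≤ m → NonZero (m ∸ 1)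
2≤⇒pred-nonZero (ℕ.s≤s (ℕ.s≤s _)) = _

fromℕℚ : ℕ → ℚ
fromℕℚ n = + n / 1

BalancedSplit : ∀ {n} (Δ : ℕ) .{{_ : NonZero Δ}} (S A B : Subset n) → Set
BalancedSplit Δ S A B =
  fromℕℚ ((∣ A ∣ ∸ 1) ℕ.⊔ (∣ B ∣ ∸ 1)) ℚ.≤
  (1ℚ ℚ.- + 1 / Δ) ℚ.* fromℕℚ (∣ S ∣ ∸ 1)

-- k = ⌊log_b m⌋: for b > 1 and m > 0, k ≤ log_b m < k + 1 says that
-- b ^ k ≤ m < b ^ (k + 1); only k ≥ 0 (that is, m ≥ 1) is covered.
IsFloorLog : (b m : ℚ) → ℕ → Set
IsFloorLog b m k = (b ^ k ℚ.≤ m) × (m ℚ.< b ^ suc k)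
  where open Exp (CommutativeRing.semiring ℚ.+-*-commutativeRing) using (_^_)

data BinaryTree (V : Set) : Set where
  leaf : V → BinaryTree V
  node : (l r : BinaryTree V) → BinaryTree V

leaves : ∀ {V} → BinaryTree V → List V
leaves (leaf x)   = x ∷ []
leaves (node l r) = leaves l ++ leaves r

module _ {n : ℕ} where
  open ListMembership (_≟_ {n}) using () renaming (_∈?_ to _∈ₗ?_)

  IsHierarchy : BinaryTree (Fin n) → Set
  IsHierarchy H = leaves H ↭ allFin n

  -- The subtree rooted at the lowest common ancestor of x and y; it is only
  -- meaningful when both are leaves of the given tree.
  lca : BinaryTree (Fin n) → (x y : Fin n) → BinaryTree (Fin n)
  lca (leaf z)   x y = leaf z
  lca (node l r) x y =
    if does (x ∈ₗ? leaves l ×-dec y ∈ₗ? leaves l) then lca l x y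
    else if does (x ∈ₗ? leaves r ×-dec y ∈ₗ? leaves r) then lca r x y
    else node l r

  -- The leaves of a hierarchy are pairwise distinct, so the length of a list
  -- of leaves is the cardinality of the corresponding set.
  height : BinaryTree (Fin n) → (x y : Fin n) → ℕ
  height H x y =
    if does (x ≟ y) then 0 else length (leaves (lca H x y)) ∸ 1

module _ {c ℓ₁ ℓ₂} (ℝ : Reals c ℓ₁ ℓ₂) where
  open Reals ℝ

  -- Weights are given on all ordered pairs, but only the values on edges
  -- matter.
  record WeightedGraph (n : ℕ) : Set (lsuc 0ℓ ⊔ c ⊔ ℓ₁ ⊔ ℓ₂) where
    field
      graph : Graph n
    open Graph graph public
    field
      w     : Fin n → Fin n → Carrier
      w-sym : ∀ {x y} → x ~ y → w x y ≈ w y x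
      w-pos : ∀ {x y} → x ~ y → 0# < w x y

  -- Each unordered pair {x , y} related by R contributes once, with x < y.
  edgeSum : ∀ {n} {R : Rel (Fin n) 0ℓ} → Decidable R →
            (Fin n → Fin n → Carrier) → Carrier
  edgeSum R? f =
    sum λ x → sum λ y → if does (x <? y ×-dec R? x y) then f x y else 0#

  record IsUltrametric {n} (u : Fin n → Fin n → Carrier) : Set (c ⊔ ℓ₁ ⊔ ℓ₂) where
    field
      nonneg    : ∀ x y → 0# ≤ u x y
      diagonal  : ∀ x → u x x ≈ 0#
      separated : ∀ x y → u x y ≈ 0# → x ≡ y
      symmetric : ∀ x y → u x y ≈ u y x
      triangle  : ∀ x y z → u x y ≤ u x z + u z y
      strong    : ∀ x y z → u x y ≤ u x z ∨ u z y

  module _ {n} (G : WeightedGraph n) where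
    open WeightedGraph G

    W : Subset n → Carrier
    W S = edgeSum (induced? S) w

    cost : (Fin n → Fin n → Carrier) → Carrier
    cost u = edgeSum _~?_ (λ x y → w x y * u x y)

    FreeFeasible : (Fin n → Fin n → Carrier) → Set (c ⊔ ℓ₁ ⊔ ℓ₂)
    FreeFeasible u =
      IsUltrametric u × (∀ x y d → IsDistance x y d → fromℕ d ≤ u x y)

    CardFeasible : BinaryTree (Fin n) → Set
    CardFeasible H =
      IsHierarchy H × (∀ x y d → IsDistance x y d → d ℕ.≤ height H x y)

    IsOPTfree : Carrier → Set (c ⊔ ℓ₁ ⊔ ℓ₂)
    IsOPTfree = IsMinimum FreeFeasible cost

    IsOPTcard : Carrier → Set (ℓ₁ ⊔ ℓ₂)
    IsOPTcard = IsMinimum CardFeasible (λ H → cost (λ x y → fromℕ (height H x y)))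

    IsMaxWeight : Carrier → Set (ℓ₁ ⊔ ℓ₂)
    IsMaxWeight = IsMaximum (λ ((x , y) : Fin n × Fin n) → x ~ y) (λ (x , y) → w x y)

    IsMinWeight : Carrier → Set (ℓ₁ ⊔ ℓ₂)
    IsMinWeight = IsMinimum (λ ((x , y) : Fin n × Fin n) → x ~ y) (λ (x , y) → w x y)

    -- For every connected G[S] with |S| ≥ 2 there is an edge e_S = ab of G[S]
    -- that is balanced and cheap; A and B are the components of a and b in
    -- G[S] − ab.
    HasCheapBalancedEdges : (Δ : ℕ) → 2 ℕ.≤ Δ → (Λ : Carrier) → Set ℓ₂
    HasCheapBalancedEdges Δ 2≤Δ Λ =
      ∀ (S : Subset n) → InducedConnected S → (2≤∣S∣ : 2 ℕ.≤ ∣ S ∣) →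
      let instance
            Δ≢0 : NonZero Δ
            Δ≢0 = 2≤⇒nonZero 2≤Δ
            ∣S∣-1≢0 : NonZero (∣ S ∣ ∸ 1)
            ∣S∣-1≢0 = 2≤⇒pred-nonZero 2≤∣S∣
      in
      ∃₂ λ a b → Induced S a b ×
        (∃₂ λ A B →
          IsComponentOf (RemoveEdge (Induced S) a b) a A ×
          IsComponentOf (RemoveEdge (Induced S) a b) b B ×
          BalancedSplit Δ S A B) ×
        w a b ≤ Λ * (W S ÷ℕ (∣ S ∣ ∸ 1))

    RatioBound : (Δ : ℕ) → 2 ℕ.≤ Δ → (Λ : Carrier) → Set (c ⊔ ℓ₁ ⊔ ℓ₂)
    RatioBound Δ 2≤Δ Λ =
      let instance
            Δ-1≢0 : NonZero (Δ ∸ 1)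
            Δ-1≢0 = 2≤⇒pred-nonZero 2≤Δ
      in
      ∀ optCard optFree k →
      IsOPTcard optCard → IsOPTfree optFree →
      IsFloorLog (+ Δ / (Δ ∸ 1)) (fromℕℚ (n ∸ 1)) k →
      QuotientAtMost optCard optFree (Λ * fromℕ (1 ℕ.+ k))

module Submission where

-- Both optima are compared with the total weight W(V).
--
-- Lower bound (W⊤≤optFree).  Adjacent vertices are at distance 1, so a feasible
-- ultrametric is at least 1 on every edge and costs at least W(V).
--
-- Upper bound (recursiveCut, optCard≤).  A hierarchy is built by removing the
-- edge e_S from a connected set S and recursing on the two components.  In the
-- resulting tree the ends of e_S have height |S| - 1, so this step costs
-- w(e_S) (|S| - 1), which is at most Λ W(S) because e_S is cheap.  The sets
-- occurring at one level of the recursion are disjoint, so a whole level costs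
-- at most Λ W(V).  Balance divides |S| - 1 by Δ/(Δ - 1) or more at each level,
-- so 1 + ⌊log (n - 1)⌋ levels suffice.  The hierarchy is feasible because any
-- two vertices of such a set S are joined by a walk of length at most |S| - 1;
-- this property is carried through the recursion, since a walk across e_S
-- consists of a walk in either part and the edge itself (dominating-join).
--
-- Bounded weight ratio (cheapBalancedEdges).  In a tree of maximum degree at
-- most Δ every connected S has a balanced edge (balancedCut): the at most Δ
-- branches at a vertex share the |S| - 1 other vertices, so one of them has at
-- least (|S| - 1)/Δ vertices; moving into such heavy branches as long as the
-- side left behind is light shrinks the branch, and where this stops both sides
-- of the edge are heavy, which says that both sides are balanced.  Any such
-- edge is cheap: its weight is at most max w ≤ Λ min w, and G[S] has at least
-- |S| - 1 edges (minW*≤W), so min w ≤ W(S)/(|S| - 1).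
--
-- The order of the reals is only assumed to be cotransitive.  Products are
-- therefore compared by multiplying with numbers known to be positive, and that
-- inverses of positive numbers are positive is deduced from the Archimedean
-- property (inverse-pos).  Acyclicity enters through cut-separates: removing an
-- edge disconnects its ends.

open import Defs
open import Data.Nat using (ℕ; _≤_)
open import Data.Product using (_×_)

open import Algebra.Bundles using (CommutativeRing)
import Algebra.Properties.CommutativeMonoid.Sum as CommutativeMonoidSum
import Algebra.Properties.Monoid.Mult as MonoidMult
import Algebra.Properties.Ring as RingProperties
import Algebra.Properties.Semiring.Exp as Exp
open import Data.Bool.Base using (if_then_else_; true; false)
open import Data.Empty using (⊥-elim)
import Data.Fin.Base as Fin
open import Data.Fin.Base using (Fin; zero; suc)
open import Data.Fin.Properties using (_≟_; _<?_; any?; <-cmp)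
open import Data.Fin.Subset as Subset
  using (Subset; _∈_; _∉_; _⊆_; _⊂_; ∣_∣; _∪_; _─_; ⁅_⁆; ∁; Nonempty; inside; outside)
open import Data.Fin.Subset.Properties
open import Data.Integer.Base as ℤ using (+_)
import Data.Integer.Properties as ℤ
open import Data.List.Base using (List; []; _∷_; _++_; length)
import Data.List.Membership.DecPropositional as DecMembership
import Data.List.Membership.Propositional as List
import Data.List.Membership.Propositional.Properties as List
open import Data.List.Membership.Propositional.Properties.WithK using (unique∧set⇒bag)
open import Data.List.Properties using (length-++)
open import Data.List.Relation.Binary.BagAndSetEquality using (∼bag⇒↭)
import Data.List.Relation.Unary.All as All
import Data.List.Relation.Unary.All.Properties as All
open import Data.List.Relation.Unary.AllPairs using ([]; _∷_)
import Data.List.Relation.Unary.Any as Any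
open import Data.List.Relation.Unary.Linked using (Linked; [-]; _∷_)
open import Data.List.Relation.Unary.Unique.Propositional using (Unique)
import Data.List.Relation.Unary.Unique.Propositional.Properties as Unique
import Data.Nat.Base as ℕ
open import Data.Nat.Base using (zero; suc; _∸_; z≤n; s≤s; _<_)
open import Data.Nat.Induction using (<-wellFounded)
import Data.Nat.Properties as ℕ
open import Data.Product.Base using (∃; ∃₂; Σ-syntax; _,_; proj₁; proj₂)
import Data.Rational.Base as ℚ
open import Data.Rational.Base using (ℚ; 0ℚ; 1ℚ; _/_)
import Data.Rational.Properties as ℚ
import Data.Rational.Unnormalised.Base as ℚᵘ
import Data.Rational.Unnormalised.Properties as ℚᵘ
import Data.Sum.Base as Sum
open import Data.Sum.Base using (_⊎_; inj₁; inj₂; [_,_]′)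
open import Data.Vec.Base using ([]; _∷_; tabulate; here; there)
open import Data.Vec.Properties using (lookup∘tabulate; lookup⇒[]=; []=⇒lookup)
open import Function.Base using (_∘_; case_of_)
open import Function.Bundles using (_⇔_; mk⇔; Equivalence)
open import Induction.WellFounded using (Acc; acc)
open import Level using (Level; 0ℓ; _⊔_)
open import Relation.Binary.Bundles using (Poset)
open import Relation.Binary.Construct.Closure.ReflexiveTransitive as Star
  using (Star; ε; _◅_; _◅◅_; reverse)
open import Relation.Binary.Core using (Rel)
open import Relation.Binary.Definitions using (Decidable; tri<; tri≈; tri>)
open import Relation.Binary.Lattice.Structures using (IsLattice)
open import Relation.Binary.PropositionalEquality.Core
  using (_≡_; _≢_; refl; sym; trans; cong; cong₂; subst)
open import Relation.Binary.PropositionalEquality.Properties using (module ≡-Reasoning)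
import Relation.Binary.Reasoning.PartialOrder as PartialOrderReasoning
import Relation.Binary.Reasoning.Setoid as SetoidReasoning
open import Relation.Nullary using (¬_; Dec; yes; no; contradiction)
open import Relation.Nullary.Decidable using (does; _×-dec_; _⊎-dec_; ¬?; dec-true; dec-false)

-- Arithmetic of the constructive order of the reals

module RealArithmetic {c ℓ₁ ℓ₂} (ℝ : Reals c ℓ₁ ℓ₂) where
  open Reals ℝ public
    renaming (_<_ to _<ᴿ_; _≤_ to _≤ᴿ_; refl to ≈-refl; sym to ≈-sym; trans to ≈-trans)
    hiding (zero; _∨_; _∧_)
  open RingProperties ring public using (-‿distribʳ-*)
  open MonoidMult +-monoid public using (×-homo-+)
  open IsLattice ≤-isLattice public
    using ()
    renaming (refl to ≤ᴿ-refl; reflexive to ≤ᴿ-reflexive; trans to ≤ᴿ-trans;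
              ≤-respˡ-≈ to ≤ᴿ-respˡ-≈; ≤-respʳ-≈ to ≤ᴿ-respʳ-≈)

  ≤ᴿ-poset : Poset c ℓ₁ ℓ₂
  ≤ᴿ-poset = record { isPartialOrder = IsLattice.isPartialOrder ≤-isLattice }

  module ≈-Reasoning = SetoidReasoning setoid
  module ≤ᴿ-Reasoning = PartialOrderReasoning ≤ᴿ-poset

  private variable x y z x′ y′ : Carrier

  <ᴿ⇒≤ᴿ : x <ᴿ y → x ≤ᴿ y
  <ᴿ⇒≤ᴿ x<y y<x = <-SPO.irrefl ≈-refl (<-SPO.trans x<y y<x)

  <-≤ᴿ-trans : x <ᴿ y → y ≤ᴿ z → x <ᴿ z
  <-≤ᴿ-trans {z = z} x<y y≤z with <-cotransitive x<y z
  ... | inj₁ x<z = x<z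
  ... | inj₂ z<y = contradiction z<y y≤z

  +-monoʳ-≤ᴿ : ∀ z → x ≤ᴿ y → z + x ≤ᴿ z + y
  +-monoʳ-≤ᴿ z x≤y z+y<z+x =
    x≤y (<-SPO.<-respˡ-≈ (cancel _) (<-SPO.<-respʳ-≈ (cancel _) (+-monoʳ-< (- z) z+y<z+x)))
    where
    cancel : ∀ t → - z + (z + t) ≈ t
    cancel t = ≈-trans (≈-sym (+-assoc (- z) z t))
                 (≈-trans (+-congʳ (-‿inverseˡ z)) (+-identityˡ t))

  +-mono-≤ᴿ : x ≤ᴿ y → x′ ≤ᴿ y′ → x + x′ ≤ᴿ y + y′
  +-mono-≤ᴿ {x} {y} {x′} {y′} x≤y x′≤y′ = ≤ᴿ-trans (+-monoʳ-≤ᴿ x x′≤y′)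
    (≤ᴿ-respˡ-≈ (+-comm y′ x) (≤ᴿ-respʳ-≈ (+-comm y′ y) (+-monoʳ-≤ᴿ y′ x≤y)))

  *-monoˡ-<ᴿ : 0# <ᴿ z → x <ᴿ y → z * x <ᴿ z * y
  *-monoˡ-<ᴿ {z} {x} {y} 0<z x<y =
    <-SPO.<-respˡ-≈ (+-identityʳ (z * x)) (<-SPO.<-respʳ-≈ collect
      (+-monoʳ-< (z * x) (*-pos 0<z 0<y-x)))
    where
    0<y-x : 0# <ᴿ - x + y
    0<y-x = <-SPO.<-respˡ-≈ (-‿inverseˡ x) (+-monoʳ-< (- x) x<y)

    collect : z * x + z * (- x + y) ≈ z * y
    collect = begin
      z * x + z * (- x + y)  ≈⟨ distribˡ z x (- x + y) ⟨
      z * (x + (- x + y))    ≈⟨ *-congˡ (+-assoc x (- x) y) ⟨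
      z * (x - x + y)        ≈⟨ *-congˡ (+-congʳ (-‿inverseʳ x)) ⟩
      z * (0# + y)           ≈⟨ *-congˡ (+-identityˡ y) ⟩
      z * y                  ∎
      where open ≈-Reasoning

  -- By cotransitivity a positive sum has a positive summand, and every summand
  -- of N y is y.
  0<fromℕ*⇒0< : ∀ N → 0# <ᴿ fromℕ N * y → 0# <ᴿ y
  0<fromℕ*⇒0< {y} zero    0<Ny = ⊥-elim (<-SPO.irrefl (≈-sym (zeroˡ y)) 0<Ny)
  0<fromℕ*⇒0< {y} (suc N) 0<Ny
    with <-cotransitive (<-SPO.<-respʳ-≈ (≈-trans (distribʳ y 1# (fromℕ N)) (+-congʳ (*-identityˡ y))) 0<Ny) y
  ... | inj₁ 0<y    = 0<y
  ... | inj₂ y<y+Ny = 0<fromℕ*⇒0< N (<-SPO.<-respˡ-≈ (-‿inverseˡ y)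
                        (<-SPO.<-respʳ-≈ cancel (+-monoʳ-< (- y) y<y+Ny)))
    where
    cancel : - y + (y + fromℕ N * y) ≈ fromℕ N * y
    cancel = ≈-trans (≈-sym (+-assoc _ _ _)) (≈-trans (+-congʳ (-‿inverseˡ y)) (+-identityˡ _))

  -- Let x < N by the Archimedean property, and locate N y relative to 0 < 1:
  -- if N y < 1, then N = x (N y) < x, which is absurd; so 0 < N y.
  inverse-pos : 0# <ᴿ x → x * y ≈ 1# → 0# <ᴿ y
  inverse-pos {x} {y} 0<x xy≈1 with archimedean x
  ... | N , x<N with <-cotransitive 0<1 (fromℕ N * y)
  ...   | inj₁ 0<Ny = 0<fromℕ*⇒0< N 0<Ny
  ...   | inj₂ Ny<1 = ⊥-elim (<-SPO.irrefl ≈-refl (<-SPO.trans x<N N<x))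
    where
    N<x : fromℕ N <ᴿ x
    N<x = <-SPO.<-respˡ-≈
      (begin
        x * (fromℕ N * y)  ≈⟨ *-congˡ (*-comm (fromℕ N) y) ⟩
        x * (y * fromℕ N)  ≈⟨ *-assoc x y (fromℕ N) ⟨
        x * y * fromℕ N    ≈⟨ *-congʳ xy≈1 ⟩
        1# * fromℕ N       ≈⟨ *-identityˡ (fromℕ N) ⟩
        fromℕ N            ∎)
      (<-SPO.<-respʳ-≈ (*-identityʳ x) (*-monoˡ-<ᴿ 0<x Ny<1))
      where open ≈-Reasoning

  ⁻¹-pos : 0# <ᴿ x → (nz : x # 0#) → 0# <ᴿ x ⁻¹⟨ nz ⟩
  ⁻¹-pos 0<x nz = inverse-pos 0<x (⁻¹-inverseʳ _ nz)

  *⁻¹-cancel : ∀ x (nz : y # 0#) → y * (x * y ⁻¹⟨ nz ⟩) ≈ x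
  *⁻¹-cancel {y} x nz = begin
    y * (x * y ⁻¹⟨ nz ⟩)  ≈⟨ *-congˡ (*-comm x _) ⟩
    y * (y ⁻¹⟨ nz ⟩ * x)  ≈⟨ *-assoc y _ x ⟨
    y * y ⁻¹⟨ nz ⟩ * x    ≈⟨ *-congʳ (⁻¹-inverseʳ y nz) ⟩
    1# * x                ≈⟨ *-identityˡ x ⟩
    x                     ∎
    where open ≈-Reasoning

  0<*⇒0<ʳ : 0# <ᴿ x → 0# <ᴿ x * y → 0# <ᴿ y
  0<*⇒0<ʳ {x} {y} 0<x 0<xy =
    <-SPO.<-respʳ-≈ (≈-trans (≈-sym (*-assoc _ x y)) (≈-trans (*-congʳ (≈-trans (*-comm _ x) (⁻¹-inverseʳ x (inj₂ 0<x)))) (*-identityˡ y)))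
      (*-pos (⁻¹-pos 0<x (inj₂ 0<x)) 0<xy)

  -- As x ≤ y is the negation of y < x, it suffices to divide the strict
  -- inequality z y < z x by z.
  *-monoˡ-≤ᴿ : 0# <ᴿ z → x ≤ᴿ y → z * x ≤ᴿ z * y
  *-monoˡ-≤ᴿ {z} {x} {y} 0<z x≤y zy<zx = x≤y y<x
    where
    0<x-y : 0# <ᴿ - y + x
    0<x-y = 0<*⇒0<ʳ 0<z (<-SPO.<-respʳ-≈
      (≈-trans (+-congʳ (-‿distribʳ-* z y)) (≈-sym (distribˡ z (- y) x)))
      (<-SPO.<-respˡ-≈ (-‿inverseˡ (z * y)) (+-monoʳ-< (- (z * y)) zy<zx)))

    y<x : y <ᴿ x
    y<x = <-SPO.<-respˡ-≈ (+-identityʳ y) (<-SPO.<-respʳ-≈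
      (≈-trans (≈-sym (+-assoc y (- y) x)) (≈-trans (+-congʳ (-‿inverseʳ y)) (+-identityˡ x)))
      (+-monoʳ-< y 0<x-y))

  *-nonneg : 0# <ᴿ x → 0# ≤ᴿ y → 0# ≤ᴿ x * y
  *-nonneg {x} 0<x 0≤y = ≤ᴿ-respˡ-≈ (zeroʳ x) (*-monoˡ-≤ᴿ 0<x 0≤y)

  fromℕ*-nonneg : ∀ k → 0# ≤ᴿ x → 0# ≤ᴿ fromℕ k * x
  fromℕ*-nonneg {x} zero    0≤x = ≤ᴿ-reflexive (≈-sym (zeroˡ x))
  fromℕ*-nonneg     (suc k) 0≤x = *-nonneg (fromℕ-suc-pos k) 0≤x

  fromℕ*-mono-≤ : ∀ k → x ≤ᴿ y → fromℕ k * x ≤ᴿ fromℕ k * y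
  fromℕ*-mono-≤ {x} {y} zero    x≤y = ≤ᴿ-reflexive (≈-trans (zeroˡ x) (≈-sym (zeroˡ y)))
  fromℕ*-mono-≤         (suc k) x≤y = *-monoˡ-≤ᴿ (fromℕ-suc-pos k) x≤y

  0<fromℕ : ∀ {m} → .{{ℕ.NonZero m}} → 0# <ᴿ fromℕ m
  0<fromℕ {suc m} = fromℕ-suc-pos m

  ÷≤⇒≤* : 0# <ᴿ y → (nz : y # 0#) → x ÷ y ⟨ nz ⟩ ≤ᴿ z → x ≤ᴿ y * z
  ÷≤⇒≤* 0<y nz x/y≤z = ≤ᴿ-respˡ-≈ (*⁻¹-cancel _ nz) (*-monoˡ-≤ᴿ 0<y x/y≤z)

  *≤⇒≤÷ : 0# <ᴿ y → (nz : y # 0#) → y * x ≤ᴿ z → x ≤ᴿ z ÷ y ⟨ nz ⟩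
  *≤⇒≤÷ {y} {x} {z} 0<y nz yx≤z =
    ≤ᴿ-respˡ-≈ (≈-trans (*-comm _ (y * x)) (≈-trans (*-assoc y x _) (*⁻¹-cancel x nz)))
      (≤ᴿ-respʳ-≈ (*-comm _ z) (*-monoˡ-≤ᴿ (⁻¹-pos 0<y nz) yx≤z))

  ≤*⇒÷≤ : 0# <ᴿ y → (nz : y # 0#) → x ≤ᴿ y * z → x ÷ y ⟨ nz ⟩ ≤ᴿ z
  ≤*⇒÷≤ {y} {x} {z} 0<y nz x≤yz =
    ≤ᴿ-respˡ-≈ (*-comm _ x) (≤ᴿ-respʳ-≈
      (≈-trans (*-comm _ (y * z)) (≈-trans (*-assoc y z _) (*⁻¹-cancel z nz)))
      (*-monoˡ-≤ᴿ (⁻¹-pos 0<y nz) x≤yz))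

-- Sums over edges

SameEdge : ∀ {n} → (a b : Fin n) → Rel (Fin n) 0ℓ
SameEdge a b x y = (x ≡ a × y ≡ b) ⊎ (x ≡ b × y ≡ a)

sameEdge? : ∀ {n} (a b : Fin n) → Decidable (SameEdge a b)
sameEdge? a b x y = (x ≟ a ×-dec y ≟ b) ⊎-dec (x ≟ b ×-dec y ≟ a)

module EdgeSums {c ℓ₁ ℓ₂} (ℝ : Reals c ℓ₁ ℓ₂) where
  open RealArithmetic ℝ
  open CommutativeMonoidSum +-commutativeMonoid using (sum-cong-≋; ∑-distrib-+; sum-replicate-zero)

  private
    variable
      n : ℕ
      p q : Level
      P : Set p
      Q : Set q
      R R′ R″ : Rel (Fin n) 0ℓ

  sum-mono-≤ : {f g : Fin n → Carrier} → (∀ i → f i ≤ᴿ g i) → sum f ≤ᴿ sum g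
  sum-mono-≤ {zero}  f≤g = ≤ᴿ-refl
  sum-mono-≤ {suc n} f≤g = +-mono-≤ᴿ (f≤g zero) (sum-mono-≤ (f≤g ∘ suc))

  sum-zero : {f : Fin n → Carrier} → (∀ i → f i ≈ 0#) → sum f ≈ 0#
  sum-zero {n} f≈0 = ≈-trans (sum-cong-≋ f≈0) (sum-replicate-zero n)

  sum-concentrated : {f : Fin n → Carrier} (i : Fin n) →
                     (∀ j → j ≢ i → f j ≈ 0#) → sum f ≈ f i
  sum-concentrated zero f≈0 =
    ≈-trans (+-congˡ (sum-zero (λ j → f≈0 (suc j) (λ ())))) (+-identityʳ _)
  sum-concentrated (suc i) f≈0 = ≈-trans
    (+-cong (f≈0 zero (λ ())) (sum-concentrated i (λ j j≢i → f≈0 (suc j) λ { refl → j≢i refl })))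
    (+-identityˡ _)

  summand-cong : (P? : Dec P) (Q? : Dec Q) → P ⇔ Q → ∀ {x y} → (P → x ≈ y) →
                 (if does P? then x else 0#) ≈ (if does Q? then y else 0#)
  summand-cong (yes p) (yes q) P⇔Q x≈y = x≈y p
  summand-cong (yes p) (no ¬q) P⇔Q x≈y = contradiction (Equivalence.to P⇔Q p) ¬q
  summand-cong (no ¬p) (yes q) P⇔Q x≈y = contradiction (Equivalence.from P⇔Q q) ¬p
  summand-cong (no ¬p) (no ¬q) P⇔Q x≈y = ≈-refl

  summand-mono-≤ : (P? : Dec P) → ∀ {x y} → (P → x ≤ᴿ y) →
                   (if does P? then x else 0#) ≤ᴿ (if does P? then y else 0#)
  summand-mono-≤ (yes p) x≤y = x≤y p
  summand-mono-≤ (no ¬p) x≤y = ≤ᴿ-refl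

  summand-zero : (P? : Dec P) → ∀ {x} → (P → x ≈ 0#) → (if does P? then x else 0#) ≈ 0#
  summand-zero (yes p) x≈0 = x≈0 p
  summand-zero (no _)  x≈0 = ≈-refl

  summand-present : (P? : Dec P) → P → ∀ {x} → (if does P? then x else 0#) ≈ x
  summand-present (yes _) p = ≈-refl
  summand-present (no ¬p) p = contradiction p ¬p

  summand-⊎ : ∀ {r} {Q′ : Set r} (P? : Dec P) (Q? : Dec Q) (Q′? : Dec Q′) →
              P ⇔ (Q ⊎ Q′) → ¬ (Q × Q′) → ∀ {x} →
              (if does P? then x else 0#) ≈
              (if does Q? then x else 0#) + (if does Q′? then x else 0#)
  summand-⊎ P?      (yes q) (yes q′) P⇔ disj = contradiction (q , q′) disj
  summand-⊎ (yes p) (yes q) (no _)   P⇔ disj = ≈-sym (+-identityʳ _)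
  summand-⊎ (yes p) (no _)  (yes q′) P⇔ disj = ≈-sym (+-identityˡ _)
  summand-⊎ (yes p) (no ¬q) (no ¬q′) P⇔ disj = ⊥-elim ([ ¬q , ¬q′ ]′ (Equivalence.to P⇔ p))
  summand-⊎ (no ¬p) (yes q) (no _)   P⇔ disj = contradiction (Equivalence.from P⇔ (inj₁ q)) ¬p
  summand-⊎ (no ¬p) (no _)  (yes q′) P⇔ disj = contradiction (Equivalence.from P⇔ (inj₂ q′)) ¬p
  summand-⊎ (no ¬p) (no _)  (no _)   P⇔ disj = ≈-sym (+-identityˡ 0#)

  edgeSum-cong : (R? : Decidable R) (R′? : Decidable R′) {f g : Fin n → Fin n → Carrier} →
                 (∀ x y → R x y ⇔ R′ x y) → (∀ x y → R x y → f x y ≈ g x y) →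
                 edgeSum ℝ R? f ≈ edgeSum ℝ R′? g
  edgeSum-cong R? R′? R⇔R′ f≈g = sum-cong-≋ λ x → sum-cong-≋ λ y →
    summand-cong (x <? y ×-dec R? x y) (x <? y ×-dec R′? x y)
      (mk⇔ (λ (x<y , r) → x<y , Equivalence.to (R⇔R′ x y) r)
           (λ (x<y , r) → x<y , Equivalence.from (R⇔R′ x y) r))
      (λ (_ , r) → f≈g x y r)

  edgeSum-mono-≤ : (R? : Decidable R) {f g : Fin n → Fin n → Carrier} →
                   (∀ x y → R x y → f x y ≤ᴿ g x y) → edgeSum ℝ R? f ≤ᴿ edgeSum ℝ R? g
  edgeSum-mono-≤ R? f≤g = sum-mono-≤ λ x → sum-mono-≤ λ y →
    summand-mono-≤ (x <? y ×-dec R? x y) (λ (_ , r) → f≤g x y r)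

  edgeSum-zero : (R? : Decidable R) {f : Fin n → Fin n → Carrier} →
                 (∀ x y → R x y → f x y ≈ 0#) → edgeSum ℝ R? f ≈ 0#
  edgeSum-zero R? {f} f≈0 = sum-zero λ x → sum-zero λ y →
    summand-zero (x <? y ×-dec R? x y) (f≈0 x y ∘ proj₂)

  edgeSum-nonneg : (R? : Decidable R) {f : Fin n → Fin n → Carrier} →
                   (∀ x y → R x y → 0# ≤ᴿ f x y) → 0# ≤ᴿ edgeSum ℝ R? f
  edgeSum-nonneg R? 0≤f = ≤ᴿ-respˡ-≈ (edgeSum-zero R? (λ _ _ _ → ≈-refl)) (edgeSum-mono-≤ R? 0≤f)

  edgeSum-⊎ : (R? : Decidable R) (R′? : Decidable R′) (R″? : Decidable R″) →
              (∀ x y → R x y ⇔ (R′ x y ⊎ R″ x y)) → (∀ x y → ¬ (R′ x y × R″ x y)) →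
              (f : Fin n → Fin n → Carrier) →
              edgeSum ℝ R? f ≈ edgeSum ℝ R′? f + edgeSum ℝ R″? f
  edgeSum-⊎ R? R′? R″? R⇔ disj f = ≈-trans
    (sum-cong-≋ λ x → ≈-trans
      (sum-cong-≋ λ y → summand-⊎ (x <? y ×-dec R? x y) (x <? y ×-dec R′? x y) (x <? y ×-dec R″? x y)
        (mk⇔ (λ (x<y , r) → Sum.map (x<y ,_) (x<y ,_) (Equivalence.to (R⇔ x y) r))
             [ (λ (x<y , r) → x<y , Equivalence.from (R⇔ x y) (inj₁ r))
             , (λ (x<y , r) → x<y , Equivalence.from (R⇔ x y) (inj₂ r)) ]′)
        (λ ((_ , r′) , (_ , r″)) → disj x y (r′ , r″)))
      (∑-distrib-+ (summand R′? x) (summand R″? x)))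
    (∑-distrib-+ (λ x → sum (summand R′? x)) (λ x → sum (summand R″? x)))
    where
    summand : {R : Rel (Fin _) 0ℓ} → Decidable R → Fin _ → Fin _ → Carrier
    summand R? x y = if does (x <? y ×-dec R? x y) then f x y else 0#

  private
    edgeSum-ordered : ∀ {n} {a b : Fin n} {R : Rel (Fin n) 0ℓ} (R? : Decidable R) →
                      a Fin.< b → R a b → (∀ x y → x Fin.< y → R x y → x ≡ a × y ≡ b) →
                      (f : Fin n → Fin n → Carrier) → edgeSum ℝ R? f ≈ f a b
    edgeSum-ordered {a = a} {b} R? a<b Rab only f = ≈-trans
      (sum-concentrated a λ x x≢a → sum-zero λ y → no-summand x y (x≢a ∘ proj₁))
      (≈-trans (sum-concentrated b λ y y≢b → no-summand a y (y≢b ∘ proj₂))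
        (summand-present (a <? b ×-dec R? a b) (a<b , Rab)))
      where
      no-summand : ∀ x y → ¬ (x ≡ a × y ≡ b) →
                   (if does (x <? y ×-dec R? x y) then f x y else 0#) ≈ 0#
      no-summand x y ≢ab = summand-zero (x <? y ×-dec R? x y)
        λ (x<y , r) → contradiction (only x y x<y r) ≢ab

  -- The sum runs over pairs x < y, so exactly one orientation of the edge ab
  -- contributes; the hypothesis on f makes it irrelevant which one.
  edgeSum-sameEdge : ∀ {n} {a b : Fin n} → a ≢ b → (f : Fin n → Fin n → Carrier) →
                     f a b ≈ f b a → edgeSum ℝ (sameEdge? a b) f ≈ f a b
  edgeSum-sameEdge {a = a} {b} a≢b f fab≈fba with <-cmp a b
  ... | tri≈ _ a≡b _ = contradiction a≡b a≢b
  ... | tri< a<b _ b≮a = edgeSum-ordered (sameEdge? a b) a<b (inj₁ (refl , refl))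
          (λ { x y x<y (inj₁ xy) → xy
             ; x y x<y (inj₂ (refl , refl)) → contradiction x<y b≮a }) f
  ... | tri> a≮b _ b<a = ≈-trans (edgeSum-ordered (sameEdge? a b) b<a (inj₂ (refl , refl))
          (λ { x y x<y (inj₂ xy) → xy
             ; x y x<y (inj₁ (refl , refl)) → contradiction x<y a≮b }) f) (≈-sym fab≈fba)

-- Cardinalities of finite sets of vertices

module _ {n : ℕ} where
  private variable S : Subset n

  nonempty⇒1≤∣∣ : ∀ {x} → x ∈ S → 1 ≤ ∣ S ∣
  nonempty⇒1≤∣∣ x∈S = ℕ.≤-trans (s≤s z≤n) (x∈p⇒∣p-x∣<∣p∣ x∈S)

  distinct⇒2≤∣∣ : ∀ {x y} → x ∈ S → y ∈ S → x ≢ y → 2 ≤ ∣ S ∣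
  distinct⇒2≤∣∣ x∈S y∈S x≢y =
    ℕ.≤-trans (s≤s (nonempty⇒1≤∣∣ (x∈p∧x≢y⇒x∈p-y x∈S x≢y))) (x∈p⇒∣p-x∣<∣p∣ y∈S)

∣∣-subadditive : ∀ {n} (S A B : Subset n) → (∀ {x} → x ∈ S → x ∈ A ⊎ x ∈ B) →
                 ∣ S ∣ ≤ ∣ A ∣ ℕ.+ ∣ B ∣
∣∣-subadditive [] [] [] cover = z≤n
∣∣-subadditive (s ∷ S) (a ∷ A) (b ∷ B) cover
  with ∣∣-subadditive S A B (Sum.map drop-there drop-there ∘ cover ∘ there) | s | a | b | cover {zero}
... | IH | outside | a       | b       | _      = ℕ.≤-trans IH (ℕ.+-mono-≤ (∣p∣≤∣x∷p∣ a A) (∣p∣≤∣x∷p∣ b B))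
... | IH | inside  | inside  | b       | _      = s≤s (ℕ.≤-trans IH (ℕ.+-monoʳ-≤ ∣ A ∣ (∣p∣≤∣x∷p∣ b B)))
... | IH | inside  | outside | inside  | _      = ℕ.≤-trans (s≤s IH) (ℕ.≤-reflexive (sym (ℕ.+-suc ∣ A ∣ ∣ B ∣)))
... | IH | inside  | outside | outside | cover₀ with cover₀ here
...   | inj₁ ()
...   | inj₂ ()

∣∣-superadditive : ∀ {n} (S A B : Subset n) → A ⊆ S → B ⊆ S → (∀ {x} → x ∈ A → x ∉ B) →
                   ∣ A ∣ ℕ.+ ∣ B ∣ ≤ ∣ S ∣
∣∣-superadditive [] [] [] _ _ _ = z≤n
∣∣-superadditive (s ∷ S) (a ∷ A) (b ∷ B) A⊆S B⊆S disj
  with ∣∣-superadditive S A B (drop-∷-⊆ A⊆S) (drop-∷-⊆ B⊆S) (λ x∈A x∈B → disj (there x∈A) (there x∈B))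
... | IH = go a b s A⊆S B⊆S disj
  where
  go : ∀ a b s → (a ∷ A) ⊆ (s ∷ S) → (b ∷ B) ⊆ (s ∷ S) → (∀ {x} → x ∈ a ∷ A → x ∉ b ∷ B) →
       ∣ a ∷ A ∣ ℕ.+ ∣ b ∷ B ∣ ≤ ∣ s ∷ S ∣
  go inside  inside  s A⊆S B⊆S disj = contradiction here (disj here)
  go inside  outside s A⊆S B⊆S disj with A⊆S here
  ... | here = s≤s IH
  go outside inside  s A⊆S B⊆S disj with B⊆S here
  ... | here = ℕ.≤-trans (ℕ.≤-reflexive (ℕ.+-suc ∣ A ∣ ∣ B ∣)) (s≤s IH)
  go outside outside s A⊆S B⊆S disj = ℕ.≤-trans IH (∣p∣≤∣x∷p∣ s S)

x∈p─q⇒x∉q : ∀ {m} (p q : Subset m) {x} → x ∈ p ─ q → x ∉ q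
x∈p─q⇒x∉q (_ ∷ p) (inside  ∷ q) (there x∈p─q) (there x∈q) = x∈p─q⇒x∉q p q x∈p─q x∈q
x∈p─q⇒x∉q (_ ∷ p) (outside ∷ q) (there x∈p─q) (there x∈q) = x∈p─q⇒x∉q p q x∈p─q x∈q

-- The union bound, by recursion on N: after the points of the first set are
-- removed from T, the remaining sets still cover the rest.
∣∣-cover : ∀ {m n} (N : Subset m) (T : Subset n) (C : Fin m → Subset n) k {t} →
           (∀ {x} → x ∈ T → ∃ λ c → c ∈ N × x ∈ C c) →
           (∀ {c} → c ∈ N → k ℕ.* ∣ C c ∣ ≤ t) →
           k ℕ.* ∣ T ∣ ≤ ∣ N ∣ ℕ.* t
∣∣-cover {n = n} [] T C k cover small
  rewrite Empty-unique {p = T} (λ (x , x∈T) → case proj₁ (proj₂ (cover x∈T)) of λ ()) | ∣⊥∣≡0 n | ℕ.*-zeroʳ k = z≤n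
∣∣-cover (outside ∷ N) T C k cover small = ∣∣-cover N T (C ∘ suc) k cover′ (small ∘ there)
  where
  cover′ : ∀ {x} → x ∈ T → ∃ λ c → c ∈ N × x ∈ C (suc c)
  cover′ x∈T with cover x∈T
  ... | suc c , there c∈N , x∈C = c , c∈N , x∈C
∣∣-cover (inside ∷ N) T C k {t} cover small = begin
  k ℕ.* ∣ T ∣                              ≤⟨ ℕ.*-monoʳ-≤ k (∣∣-subadditive T (C zero) (T ─ C zero) split) ⟩
  k ℕ.* (∣ C zero ∣ ℕ.+ ∣ T ─ C zero ∣)    ≡⟨ ℕ.*-distribˡ-+ k ∣ C zero ∣ _ ⟩
  k ℕ.* ∣ C zero ∣ ℕ.+ k ℕ.* ∣ T ─ C zero ∣
    ≤⟨ ℕ.+-mono-≤ (small here) (∣∣-cover N (T ─ C zero) (C ∘ suc) k cover′ (small ∘ there)) ⟩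
  t ℕ.+ ∣ N ∣ ℕ.* t                        ∎
  where
  open ℕ.≤-Reasoning
  split : ∀ {x} → x ∈ T → x ∈ C zero ⊎ x ∈ T ─ C zero
  split {x} x∈T with x ∈? C zero
  ... | yes x∈C = inj₁ x∈C
  ... | no  x∉C = inj₂ (x∈p∧x∉q⇒x∈p─q x∈T x∉C)

  cover′ : ∀ {x} → x ∈ T ─ C zero → ∃ λ c → c ∈ N × x ∈ C (suc c)
  cover′ {x} x∈T─C with cover (p─q⊆p T (C zero) x∈T─C)
  ... | zero  , _         , x∈C = contradiction x∈C (x∈p─q⇒x∉q T (C zero) x∈T─C)
  ... | suc c , there c∈N , x∈C = c , c∈N , x∈C

-- Components and simple paths

module _ {n : ℕ} {R : Rel (Fin n) 0ℓ} where

  -- A set of reachable vertices that is not yet closed under R is enlarged by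
  -- the far end of an edge leaving it.
  component : Decidable R → (a : Fin n) → ∃ (IsComponentOf R a)
  component R? a = grow ⁅ a ⁆ (x∈⁅x⁆ a) (λ x∈⁅a⁆ → subst (Star R a) (sym (x∈⁅y⁆⇒x≡y a x∈⁅a⁆)) ε) (<-wellFounded _)
    where
    grow : (C : Subset n) → a ∈ C → (∀ {x} → x ∈ C → Star R a x) → Acc _<_ ∣ ∁ C ∣ → ∃ (IsComponentOf R a)
    grow C a∈C reachable (acc smaller)
      with any? (λ x → any? (λ y → x ∈? C ×-dec ¬? (y ∈? C) ×-dec R? x y))
    ... | yes (x , y , x∈C , y∉C , Rxy) =
      grow (C ∪ ⁅ y ⁆) (p⊆p∪q ⁅ y ⁆ a∈C) reachable′
        (smaller (p⊂q⇒∣p∣<∣q∣ (p⊂q⇒∁p⊃∁q (p⊆p∪q ⁅ y ⁆ , y , x∈p∪q⁺ (inj₂ (x∈⁅x⁆ y)) , y∉C))))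
      where
      reachable′ : ∀ {z} → z ∈ C ∪ ⁅ y ⁆ → Star R a z
      reachable′ z∈ with x∈p∪q⁻ C ⁅ y ⁆ z∈
      ... | inj₁ z∈C = reachable z∈C
      ... | inj₂ z∈⁅y⁆ rewrite x∈⁅y⁆⇒x≡y y z∈⁅y⁆ = reachable x∈C ◅◅ (Rxy ◅ ε)
    ... | no closed = C , λ x → mk⇔ reachable (reached a∈C)
      where
      reached : ∀ {x z} → x ∈ C → Star R x z → z ∈ C
      reached x∈C ε = x∈C
      reached {x} x∈C (_◅_ {j = y} Rxy path) with y ∈? C
      ... | yes y∈C = reached y∈C path
      ... | no y∉C  = contradiction (x , y , x∈C , y∉C , Rxy) closed

  -- The list holds the vertices before the last one, so that zs ++ y ∷ [] is
  -- the whole vertex sequence; acyclicity speaks about lists of this shape.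
  data Trail : Fin n → List (Fin n) → Fin n → Set where
    []  : ∀ {x} → Trail x [] x
    _∷_ : ∀ {x x′ y zs} → R x x′ → Trail x′ zs y → Trail x (x ∷ zs) y

  private variable
    x y v : Fin n
    zs : List (Fin n)

  Simple : List (Fin n) → Fin n → Set
  Simple zs y = Unique (zs ++ y ∷ [])

  trailFrom : Trail x zs y → Simple zs y → v List.∈ zs ++ y ∷ [] → ∃ λ zs′ → Trail v zs′ y × Simple zs′ y
  trailFrom []      simple       (Any.here refl)  = [] , [] , simple
  trailFrom (r ∷ t) simple       (Any.here refl)  = _ , r ∷ t , simple
  trailFrom (r ∷ t) (_ ∷ simple) (Any.there v∈zs) = trailFrom t simple v∈zs

  -- If x already lies on the simple trail from its successor, that trail is
  -- entered at x instead, which cuts off the loop.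
  simpleTrail : Star R x y → ∃ λ zs → Trail x zs y × Simple zs y
  simpleTrail ε = [] , [] , All.[] ∷ []
  simpleTrail {x} {y} (r ◅ path) with simpleTrail path
  ... | zs , t , simple with Any.any? (x ≟_) (zs ++ y ∷ [])
  ...   | yes x∈zs = trailFrom t simple x∈zs
  ...   | no x∉zs  = x ∷ zs , r ∷ t , All.¬Any⇒All¬ _ x∉zs ∷ simple

  trail-linked : {R′ : Rel (Fin n) 0ℓ} → (∀ {x y} → R x y → R′ x y) →
                 Trail x zs y → Linked R′ (zs ++ y ∷ [])
  trail-linked R⇒R′ []            = [-]
  trail-linked R⇒R′ (r ∷ [])      = R⇒R′ r ∷ [-]
  trail-linked R⇒R′ (r ∷ r′ ∷ t)  = R⇒R′ r ∷ trail-linked R⇒R′ (r′ ∷ t)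

removeEdge-swap : ∀ {n} {R : Rel (Fin n) 0ℓ} {a b x y} → RemoveEdge R a b x y → RemoveEdge R b a x y
removeEdge-swap (r , ≢ab) = r , ≢ab ∘ Sum.swap

removeEdge-sym : ∀ {n} {R : Rel (Fin n) 0ℓ} {a b} → (∀ {x y} → R x y → R y x) →
                 ∀ {x y} → RemoveEdge R a b x y → RemoveEdge R a b y x
removeEdge-sym R-sym (r , ≢ab) = R-sym r , ≢ab ∘
  λ { (inj₁ (y≡a , x≡b)) → inj₂ (x≡b , y≡a) ; (inj₂ (y≡b , x≡a)) → inj₁ (x≡a , y≡b) }

isComponentOf-swap : ∀ {n} {R : Rel (Fin n) 0ℓ} {a b v C} →
                     IsComponentOf (RemoveEdge R a b) v C → IsComponentOf (RemoveEdge R b a) v C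
isComponentOf-swap {R = R} isC x = mk⇔ (Star.map (removeEdge-swap {R = R}) ∘ Equivalence.to (isC x))
                               (Equivalence.from (isC x) ∘ Star.map (removeEdge-swap {R = R}))

-- Removing an edge from an induced subtree

module EdgeRemoval {n} (G : Graph n) (acyclic : Graph.Acyclic G) where
  open Graph G

  induced-sym : ∀ {S x y} → Induced S x y → Induced S y x
  induced-sym (x∈S , y∈S , x~y) = y∈S , x∈S , ~-sym x~y

  ~⇒≢ : ∀ {x y} → x ~ y → x ≢ y
  ~⇒≢ x~x refl = ~-irrefl x~x

  module _ {S : Subset n} where
    Cut : (a b : Fin n) → Rel (Fin n) 0ℓ
    Cut = RemoveEdge (Induced S)

    -- A simple path between the ends of the removed edge has an inner vertex,
    -- so it closes up to a cycle.
    cut-separates : ∀ {a b} → Induced S a b → ¬ Star (Cut a b) a b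
    cut-separates {a} {b} (_ , _ , a~b) path with simpleTrail path
    ... | _ , []            , _      = ~-irrefl a~b
    ... | _ , r ∷ []        , _      = proj₂ r (inj₁ (refl , refl))
    ... | _ , t@(_ ∷ (_ ∷ _)) , simple = acyclic _ _ _ b simple (trail-linked (proj₂ ∘ proj₂ ∘ proj₁) t) (~-sym a~b)

    module _ {a b : Fin n} {C : Subset n} (isC : IsComponentOf (Cut a b) a C) where
      root∈ : a ∈ C
      root∈ = Equivalence.from (isC a) ε

      component-step : ∀ {x y} → x ∈ C → Cut a b x y → y ∈ C
      component-step {x} {y} x∈C r = Equivalence.from (isC y) (Equivalence.to (isC x) x∈C ◅◅ (r ◅ ε))

      component⊆ : a ∈ S → C ⊆ S
      component⊆ a∈S {x} x∈C = last∈S a∈S (Equivalence.to (isC x) x∈C)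
        where
        last∈S : ∀ {u v} → u ∈ S → Star (Cut a b) u v → v ∈ S
        last∈S u∈S ε = u∈S
        last∈S _ (((_ , v∈S , _) , _) ◅ path) = last∈S v∈S path

      component-connected : InducedConnected C
      component-connected x y x∈C y∈C = within x∈C
        (reverse (removeEdge-sym induced-sym) (Equivalence.to (isC x) x∈C) ◅◅ Equivalence.to (isC y) y∈C)
        where
        within : ∀ {u v} → u ∈ C → Star (Cut a b) u v → Star (Induced C) u v
        within u∈C ε = ε
        within u∈C (r ◅ path) = (u∈C , component-step u∈C r , proj₂ (proj₂ (proj₁ r))) ◅ within (component-step u∈C r) path

  -- Every recursion over connected vertex sets removes an edge ab of G[S] and
  -- continues with the two components A and B; these are the facts it uses.
  record EdgeSplit (S : Subset n) (a b : Fin n) (A B : Subset n) : Set where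
    field
      edge        : Induced S a b
      a∈A         : a ∈ A
      b∈B         : b ∈ B
      A-connected : InducedConnected A
      B-connected : InducedConnected B
      cover       : ∀ {x} → x ∈ S → x ∈ A ⊎ x ∈ B
      A⊆S         : A ⊆ S
      B⊆S         : B ⊆ S
      disjoint    : ∀ {x} → x ∈ A → x ∉ B
      edges       : ∀ x y → Induced S x y ⇔ (SameEdge a b x y ⊎ (Induced A x y ⊎ Induced B x y))

    ∣S∣≡∣A∣+∣B∣ : ∣ S ∣ ≡ ∣ A ∣ ℕ.+ ∣ B ∣
    ∣S∣≡∣A∣+∣B∣ = ℕ.≤-antisym (∣∣-subadditive S A B cover) (∣∣-superadditive S A B A⊆S B⊆S disjoint)

    -- Truncation is harmless because both parts are nonempty; the extra 1 counts
    -- the edge ab.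
    ∣S∣∸1≡ : ∣ S ∣ ∸ 1 ≡ suc ((∣ A ∣ ∸ 1) ℕ.+ (∣ B ∣ ∸ 1))
    ∣S∣∸1≡ rewrite ∣S∣≡∣A∣+∣B∣ with ∣ A ∣ | ∣ B ∣ | nonempty⇒1≤∣∣ a∈A | nonempty⇒1≤∣∣ b∈B
    ... | suc p | suc q | _ | _ = ℕ.+-suc p q

    ∣A∣<∣S∣ : ∣ A ∣ < ∣ S ∣
    ∣A∣<∣S∣ rewrite ∣S∣≡∣A∣+∣B∣ = ℕ.m<m+n ∣ A ∣ (nonempty⇒1≤∣∣ b∈B)

    ∣B∣<∣S∣ : ∣ B ∣ < ∣ S ∣
    ∣B∣<∣S∣ rewrite ∣S∣≡∣A∣+∣B∣ = ℕ.m<n+m ∣ B ∣ (nonempty⇒1≤∣∣ a∈A)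

    a≢b : a ≢ b
    a≢b = ~⇒≢ (proj₂ (proj₂ edge))

    sameEdge⇒¬parts : ∀ x y → ¬ (SameEdge a b x y × (Induced A x y ⊎ Induced B x y))
    sameEdge⇒¬parts x y (inj₁ (refl , refl) , inj₁ (_ , b∈A , _)) = disjoint b∈A b∈B
    sameEdge⇒¬parts x y (inj₁ (refl , refl) , inj₂ (a∈B , _ , _)) = disjoint a∈A a∈B
    sameEdge⇒¬parts x y (inj₂ (refl , refl) , inj₁ (b∈A , _ , _)) = disjoint b∈A b∈B
    sameEdge⇒¬parts x y (inj₂ (refl , refl) , inj₂ (_ , a∈B , _)) = disjoint a∈A a∈B

  -- Along walks from a each vertex lies in A or in B, and a vertex in both
  -- would connect a with b without the edge ab.
  edgeSplit : ∀ {S a b A B} → InducedConnected S → Induced S a b →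
              IsComponentOf (RemoveEdge (Induced S) a b) a A →
              IsComponentOf (RemoveEdge (Induced S) a b) b B →
              EdgeSplit S a b A B
  edgeSplit {S} {a} {b} {A} {B} connected edge@(a∈S , b∈S , _) isA isB = record
    { edge        = edge
    ; a∈A         = root∈ isA
    ; b∈B         = root∈ isB′
    ; A-connected = component-connected isA
    ; B-connected = component-connected isB′
    ; cover       = λ {x} x∈S → cover (inj₁ (root∈ isA)) (connected a x a∈S x∈S)
    ; A⊆S         = A⊆S
    ; B⊆S         = B⊆S
    ; disjoint    = disjoint
    ; edges       = λ x y → mk⇔ (edges⇒ x y) edges⇐
    }
    where
    isB′ = isComponentOf-swap isB

    A⊆S : A ⊆ S
    A⊆S = component⊆ isA a∈S

    B⊆S : B ⊆ S
    B⊆S = component⊆ isB′ b∈S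

    disjoint : ∀ {x} → x ∈ A → x ∉ B
    disjoint {x} x∈A x∈B = cut-separates edge
      (Equivalence.to (isA x) x∈A ◅◅ reverse (removeEdge-sym induced-sym) (Equivalence.to (isB x) x∈B))

    step : ∀ {x y} → x ∈ A ⊎ x ∈ B → Induced S x y →
           SameEdge a b x y ⊎ ((x ∈ A × y ∈ A) ⊎ (x ∈ B × y ∈ B))
    step {x} {y} x∈ xy with sameEdge? a b x y
    ... | yes xy≡ab = inj₁ xy≡ab
    ... | no  xy≢ab = inj₂ (Sum.map (λ x∈A → x∈A , component-step isA x∈A (xy , xy≢ab))
                                    (λ x∈B → x∈B , component-step isB′ x∈B (removeEdge-swap {R = Induced S} (xy , xy≢ab))) x∈)

    cover : ∀ {x z} → x ∈ A ⊎ x ∈ B → Star (Induced S) x z → z ∈ A ⊎ z ∈ B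
    cover x∈ ε = x∈
    cover x∈ (xy ◅ path) with step x∈ xy
    ... | inj₁ (inj₁ (_ , refl)) = cover (inj₂ (root∈ isB′)) path
    ... | inj₁ (inj₂ (_ , refl)) = cover (inj₁ (root∈ isA)) path
    ... | inj₂ parts             = cover (Sum.map proj₂ proj₂ parts) path

    edges⇒ : ∀ x y → Induced S x y → SameEdge a b x y ⊎ (Induced A x y ⊎ Induced B x y)
    edges⇒ x y xy@(x∈S , _ , x~y) with step (cover (inj₁ (root∈ isA)) (connected a x a∈S x∈S)) xy
    ... | inj₁ xy≡ab                = inj₁ xy≡ab
    ... | inj₂ (inj₁ (x∈A , y∈A)) = inj₂ (inj₁ (x∈A , y∈A , x~y))
    ... | inj₂ (inj₂ (x∈B , y∈B)) = inj₂ (inj₂ (x∈B , y∈B , x~y))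

    edges⇐ : ∀ {x y} → SameEdge a b x y ⊎ (Induced A x y ⊎ Induced B x y) → Induced S x y
    edges⇐ (inj₁ (inj₁ (refl , refl)))        = edge
    edges⇐ (inj₁ (inj₂ (refl , refl)))        = induced-sym edge
    edges⇐ (inj₂ (inj₁ (x∈A , y∈A , x~y))) = A⊆S x∈A , A⊆S y∈A , x~y
    edges⇐ (inj₂ (inj₂ (x∈B , y∈B , x~y))) = B⊆S x∈B , B⊆S y∈B , x~y

-- Hierarchies on sets of vertices and their heights

module _ {n : ℕ} where
  open DecMembership (_≟_ {n}) renaming (_∈_ to _∈ₗ_; _∉_ to _∉ₗ_; _∈?_ to _∈ₗ?_)

  private variable
    H l r : BinaryTree (Fin n)
    x y : Fin n

  ∣leaves-lca∣≤ : ∀ H → length (leaves (lca H x y)) ≤ length (leaves H)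
  ∣leaves-lca∣≤ (leaf z) = ℕ.≤-refl
  ∣leaves-lca∣≤ {x} {y} (node l r)
    with does (x ∈ₗ? leaves l ×-dec y ∈ₗ? leaves l) | does (x ∈ₗ? leaves r ×-dec y ∈ₗ? leaves r)
  ... | true  | _     = ℕ.≤-trans (∣leaves-lca∣≤ l)
          (ℕ.≤-trans (ℕ.m≤m+n _ _) (ℕ.≤-reflexive (sym (length-++ (leaves l)))))
  ... | false | true  = ℕ.≤-trans (∣leaves-lca∣≤ r)
          (ℕ.≤-trans (ℕ.m≤n+m _ _) (ℕ.≤-reflexive (sym (length-++ (leaves l)))))
  ... | false | false = ℕ.≤-refl

  height≤ : ∀ H → height H x y ≤ length (leaves H) ∸ 1
  height≤ {x} {y} H with does (x ≟ y)
  ... | true  = z≤n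
  ... | false = ℕ.∸-monoˡ-≤ 1 (∣leaves-lca∣≤ H)

  height-left : x ∈ₗ leaves l → y ∈ₗ leaves l → height (node l r) x y ≡ height l x y
  height-left {x} {l} {y} x∈l y∈l
    rewrite dec-true (x ∈ₗ? leaves l ×-dec y ∈ₗ? leaves l) (x∈l , y∈l) = refl

  height-right : x ∉ₗ leaves l → x ∈ₗ leaves r → y ∈ₗ leaves r → height (node l r) x y ≡ height r x y
  height-right {x} {l} {r} {y} x∉l x∈r y∈r
    rewrite dec-false (x ∈ₗ? leaves l ×-dec y ∈ₗ? leaves l) (x∉l ∘ proj₁)
          | dec-true (x ∈ₗ? leaves r ×-dec y ∈ₗ? leaves r) (x∈r , y∈r) = refl

  height-top : x ≢ y → ¬ (x ∈ₗ leaves l × y ∈ₗ leaves l) → ¬ (x ∈ₗ leaves r × y ∈ₗ leaves r) →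
               height (node l r) x y ≡ length (leaves (node l r)) ∸ 1
  height-top {x} {y} {l} {r} x≢y ¬both∈l ¬both∈r
    rewrite dec-false (x ≟ y) x≢y
          | dec-false (x ∈ₗ? leaves l ×-dec y ∈ₗ? leaves l) ¬both∈l
          | dec-false (x ∈ₗ? leaves r ×-dec y ∈ₗ? leaves r) ¬both∈r = refl

  -- Hierarchies on subsets of V, for the recursion: the leaves are the elements
  -- of S instead of all vertices.
  record HierarchyOn (S : Subset n) : Set where
    field
      tree     : BinaryTree (Fin n)
      unique   : Unique (leaves tree)
      ∈leaves⇔ : ∀ x → x ∈ₗ leaves tree ⇔ x ∈ S
      ∣leaves∣ : length (leaves tree) ≡ ∣ S ∣

    level : Fin n → Fin n → ℕ
    level = height tree

    level≤ : ∀ {x y} → level x y ≤ ∣ S ∣ ∸ 1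
    level≤ = ℕ.≤-trans (height≤ tree) (ℕ.≤-reflexive (cong (_∸ 1) ∣leaves∣))

    ∉leaves : ∀ {x} → x ∉ S → x ∉ₗ leaves tree
    ∉leaves x∉S = x∉S ∘ Equivalence.to (∈leaves⇔ _)

  hierarchyOn-singleton : ∀ {S x} → x ∈ S → ∣ S ∣ ≡ 1 → HierarchyOn S
  hierarchyOn-singleton {S} {x} x∈S ∣S∣≡1 = record
    { tree     = leaf x
    ; unique   = All.[] ∷ []
    ; ∈leaves⇔ = λ y → mk⇔ (λ { (Any.here refl) → x∈S }) (λ y∈S → Any.here (only y∈S))
    ; ∣leaves∣ = sym ∣S∣≡1
    }
    where
    only : ∀ {y} → y ∈ S → y ≡ x
    only {y} y∈S with y ≟ x
    ... | yes y≡x = y≡x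
    ... | no  y≢x = contradiction (distinct⇒2≤∣∣ y∈S x∈S y≢x) (ℕ.<⇒≱ (ℕ.≤-reflexive (cong suc ∣S∣≡1)))

  hierarchy : (H : HierarchyOn Subset.⊤) → IsHierarchy (HierarchyOn.tree H)
  hierarchy H = ∼bag⇒↭ (unique∧set⇒bag unique (Unique.allFin⁺ n)
    (λ {x} → mk⇔ (λ _ → List.∈-allFin x) (λ _ → Equivalence.from (∈leaves⇔ x) ∈⊤)))
    where open HierarchyOn H

  -- Among the edges of G[S] only ab is separated at the root, at height |S| - 1;
  -- inside A and inside B the heights are unchanged.
  module Join (G : Graph n) (acyclic : Graph.Acyclic G) {S A B : Subset n} {a b : Fin n}
              (split : EdgeRemoval.EdgeSplit G acyclic S a b A B)
              (HA : HierarchyOn A) (HB : HierarchyOn B) where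
    open EdgeRemoval.EdgeSplit split
    private
      module HA = HierarchyOn HA
      module HB = HierarchyOn HB

    join : HierarchyOn S
    join = record
      { tree     = node HA.tree HB.tree
      ; unique   = Unique.++⁺ HA.unique HB.unique
          (λ (x∈A , x∈B) → disjoint (Equivalence.to (HA.∈leaves⇔ _) x∈A) (Equivalence.to (HB.∈leaves⇔ _) x∈B))
      ; ∈leaves⇔ = λ x → mk⇔
          (λ x∈ → [ A⊆S ∘ Equivalence.to (HA.∈leaves⇔ x) , B⊆S ∘ Equivalence.to (HB.∈leaves⇔ x) ]′
                    (List.∈-++⁻ (leaves HA.tree) x∈))
          (λ x∈S → [ List.∈-++⁺ˡ ∘ Equivalence.from (HA.∈leaves⇔ x)
                   , List.∈-++⁺ʳ (leaves HA.tree) ∘ Equivalence.from (HB.∈leaves⇔ x) ]′ (cover x∈S))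
      ; ∣leaves∣ = trans (length-++ (leaves HA.tree)) (trans (cong₂ ℕ._+_ HA.∣leaves∣ HB.∣leaves∣) (sym ∣S∣≡∣A∣+∣B∣))
      }

    open HierarchyOn join using (level; ∣leaves∣)

    level-A : ∀ {x y} → x ∈ A → y ∈ A → level x y ≡ HA.level x y
    level-A x∈A y∈A = height-left {l = HA.tree} {r = HB.tree}
      (Equivalence.from (HA.∈leaves⇔ _) x∈A) (Equivalence.from (HA.∈leaves⇔ _) y∈A)

    level-B : ∀ {x y} → x ∈ B → y ∈ B → level x y ≡ HB.level x y
    level-B x∈B y∈B = height-right {l = HA.tree} {r = HB.tree} (HA.∉leaves (λ x∈A → disjoint x∈A x∈B))
      (Equivalence.from (HB.∈leaves⇔ _) x∈B) (Equivalence.from (HB.∈leaves⇔ _) y∈B)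

    level-AB : ∀ {x y} → x ∈ A → y ∈ B → level x y ≡ ∣ S ∣ ∸ 1
    level-AB x∈A y∈B = trans
      (height-top {l = HA.tree} {r = HB.tree} (λ { refl → disjoint x∈A y∈B })
        (λ (_ , y∈l) → HA.∉leaves (λ y∈A → disjoint y∈A y∈B) y∈l)
        (λ (x∈r , _) → HB.∉leaves (disjoint x∈A) x∈r))
      (cong (_∸ 1) ∣leaves∣)

    level-BA : ∀ {x y} → x ∈ B → y ∈ A → level x y ≡ ∣ S ∣ ∸ 1
    level-BA x∈B y∈A = trans
      (height-top {l = HA.tree} {r = HB.tree} (λ { refl → disjoint y∈A x∈B })
        (λ (x∈l , _) → HA.∉leaves (λ x∈A → disjoint x∈A x∈B) x∈l)
        (λ (_ , y∈r) → HB.∉leaves (disjoint y∈A) y∈r))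
      (cong (_∸ 1) ∣leaves∣)

module _ {V : Set} {R : Rel V 0ℓ} where
  walkLength-◅◅ : ∀ {x y z} (p : Star R x y) (q : Star R y z) →
                  walkLength (p ◅◅ q) ≡ walkLength p ℕ.+ walkLength q
  walkLength-◅◅ ε       q = refl
  walkLength-◅◅ (_ ◅ p) q = cong suc (walkLength-◅◅ p q)

module Domination {n} (G : Graph n) (acyclic : Graph.Acyclic G) where
  open Graph G
  open EdgeRemoval G acyclic

  WalkWithin : ℕ → Rel (Fin n) 0ℓ
  WalkWithin d x y = Σ[ p ∈ Star _~_ x y ] walkLength p ≤ d

  -- The heights dominate the distances; the walks witness this without any
  -- distance being computed.
  Dominating : ∀ {S} → HierarchyOn S → Set
  Dominating {S} H = ∀ {x y} → x ∈ S → y ∈ S → WalkWithin (HierarchyOn.level H x y) x y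

  dominating-singleton : ∀ {S x} (x∈S : x ∈ S) (∣S∣≡1 : ∣ S ∣ ≡ 1) → Dominating (hierarchyOn-singleton x∈S ∣S∣≡1)
  dominating-singleton {S} x∈S ∣S∣≡1 {y} {z} y∈S z∈S with y ≟ z
  ... | yes refl = ε , z≤n
  ... | no  y≢z  = contradiction (distinct⇒2≤∣∣ y∈S z∈S y≢z) (ℕ.<⇒≱ (ℕ.≤-reflexive (cong suc ∣S∣≡1)))

  -- A walk from A to B passes through ab, and |S| - 1 is one more than the sum
  -- of the bounds |A| - 1 and |B| - 1 on its other two pieces.
  dominating-join : ∀ {S A B a b} (split : EdgeSplit S a b A B) {HA : HierarchyOn A} {HB : HierarchyOn B} →
                    Dominating HA → Dominating HB → Dominating (Join.join G acyclic split HA HB)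
  dominating-join {S} {A} {B} {a} {b} split {HA} {HB} domA domB x∈S y∈S = go (cover x∈S) (cover y∈S)
    where
    open EdgeSplit split
    open Join G acyclic split HA HB
    open HierarchyOn join using (level)
    open ℕ.≤-Reasoning

    across : ∀ {A B p q u v} (HA : HierarchyOn A) (HB : HierarchyOn B) → Dominating HA → Dominating HB →
             u ∈ A → p ∈ A → p ~ q → q ∈ B → v ∈ B → WalkWithin (suc ((∣ A ∣ ∸ 1) ℕ.+ (∣ B ∣ ∸ 1))) u v
    across {A} {B} HA HB domA domB u∈A p∈A p~q q∈B v∈B
      with domA u∈A p∈A | domB q∈B v∈B
    ... | up , up≤ | qv , qv≤ = up ◅◅ (p~q ◅ qv) , (begin
      walkLength (up ◅◅ (p~q ◅ qv))            ≡⟨ walkLength-◅◅ up (p~q ◅ qv) ⟩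
      walkLength up ℕ.+ suc (walkLength qv)    ≡⟨ ℕ.+-suc _ _ ⟩
      suc (walkLength up ℕ.+ walkLength qv)
        ≤⟨ s≤s (ℕ.+-mono-≤ (ℕ.≤-trans up≤ (HierarchyOn.level≤ HA)) (ℕ.≤-trans qv≤ (HierarchyOn.level≤ HB))) ⟩
      suc ((∣ A ∣ ∸ 1) ℕ.+ (∣ B ∣ ∸ 1))        ∎)

    a~b : a ~ b
    a~b = proj₂ (proj₂ edge)

    go : ∀ {x y} → x ∈ A ⊎ x ∈ B → y ∈ A ⊎ y ∈ B → WalkWithin (level x y) x y
    go (inj₁ x∈A) (inj₁ y∈A) = subst (λ d → WalkWithin d _ _) (sym (level-A x∈A y∈A)) (domA x∈A y∈A)
    go (inj₂ x∈B) (inj₂ y∈B) = subst (λ d → WalkWithin d _ _) (sym (level-B x∈B y∈B)) (domB x∈B y∈B)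
    go (inj₁ x∈A) (inj₂ y∈B) = subst (λ d → WalkWithin d _ _)
      (sym (trans (level-AB x∈A y∈B) ∣S∣∸1≡)) (across HA HB domA domB x∈A a∈A a~b b∈B y∈B)
    go (inj₂ x∈B) (inj₁ y∈A) = subst (λ d → WalkWithin d _ _)
      (sym (trans (level-BA x∈B y∈A) (trans ∣S∣∸1≡ (cong suc (ℕ.+-comm (∣ A ∣ ∸ 1) (∣ B ∣ ∸ 1))))))
      (across HB HA domB domA x∈B b∈B (~-sym a~b) a∈A y∈A)

-- The rational numbers 1 - 1/Δ and Δ/(Δ - 1)

toℚᵘ-fromℕℚ : ∀ m → ℚ.toℚᵘ (fromℕℚ m) ℚᵘ.≃ ℚᵘ.mkℚᵘ (+ m) 0
toℚᵘ-fromℕℚ m = ℚ.toℚᵘ-fromℚᵘ (ℚᵘ.mkℚᵘ (+ m) 0)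

fromℕℚ-+ : ∀ m n → fromℕℚ (m ℕ.+ n) ≡ fromℕℚ m ℚ.+ fromℕℚ n
fromℕℚ-+ m n = ℚ.toℚᵘ-injective (begin
  ℚ.toℚᵘ (fromℕℚ (m ℕ.+ n))                       ≈⟨ toℚᵘ-fromℕℚ (m ℕ.+ n) ⟩
  ℚᵘ.mkℚᵘ (+ (m ℕ.+ n)) 0
    ≈⟨ ℚᵘ.*≡* (cong (ℤ._* + 1) (trans (ℤ.pos-+ m n) (cong₂ ℤ._+_ (sym (ℤ.*-identityʳ (+ m))) (sym (ℤ.*-identityʳ (+ n)))))) ⟩
  ℚᵘ.mkℚᵘ (+ m) 0 ℚᵘ.+ ℚᵘ.mkℚᵘ (+ n) 0            ≈⟨ ℚᵘ.+-cong (toℚᵘ-fromℕℚ m) (toℚᵘ-fromℕℚ n) ⟨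
  ℚ.toℚᵘ (fromℕℚ m) ℚᵘ.+ ℚ.toℚᵘ (fromℕℚ n)        ≈⟨ ℚ.toℚᵘ-homo-+ (fromℕℚ m) (fromℕℚ n) ⟨
  ℚ.toℚᵘ (fromℕℚ m ℚ.+ fromℕℚ n)                  ∎)
  where open ℚᵘ.≃-Reasoning

/-*-cancel : ∀ m k .{{_ : ℕ.NonZero k}} → (+ m / k) ℚ.* fromℕℚ k ≡ fromℕℚ m
/-*-cancel m (suc k) = ℚ.toℚᵘ-injective (begin
  ℚ.toℚᵘ ((+ m / suc k) ℚ.* fromℕℚ (suc k))               ≈⟨ ℚ.toℚᵘ-homo-* (+ m / suc k) (fromℕℚ (suc k)) ⟩
  ℚ.toℚᵘ (+ m / suc k) ℚᵘ.* ℚ.toℚᵘ (fromℕℚ (suc k))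
    ≈⟨ ℚᵘ.*-cong (ℚ.toℚᵘ-fromℚᵘ (ℚᵘ.mkℚᵘ (+ m) k)) (toℚᵘ-fromℕℚ (suc k)) ⟩
  ℚᵘ.mkℚᵘ (+ m) k ℚᵘ.* ℚᵘ.mkℚᵘ (+ suc k) 0
    ≈⟨ ℚᵘ.*≡* (trans (ℤ.*-assoc (+ m) (+ suc k) (+ 1)) (cong (+ m ℤ.*_) (trans (ℤ.*-identityʳ (+ suc k)) (cong +_ (sym (ℕ.*-identityʳ (suc k))))))) ⟩
  ℚᵘ.mkℚᵘ (+ m) 0                                         ≈⟨ toℚᵘ-fromℕℚ m ⟨
  ℚ.toℚᵘ (fromℕℚ m)                                       ∎)
  where open ℚᵘ.≃-Reasoning

fromℕℚ-* : ∀ m n → fromℕℚ (m ℕ.* n) ≡ fromℕℚ m ℚ.* fromℕℚ n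
fromℕℚ-* zero    n = sym (ℚ.*-zeroˡ (fromℕℚ n))
fromℕℚ-* (suc m) n = begin
  fromℕℚ (n ℕ.+ m ℕ.* n)                          ≡⟨ fromℕℚ-+ n (m ℕ.* n) ⟩
  fromℕℚ n ℚ.+ fromℕℚ (m ℕ.* n)                   ≡⟨ cong₂ ℚ._+_ (sym (ℚ.*-identityˡ (fromℕℚ n))) (fromℕℚ-* m n) ⟩
  1ℚ ℚ.* fromℕℚ n ℚ.+ fromℕℚ m ℚ.* fromℕℚ n       ≡⟨ ℚ.*-distribʳ-+ (fromℕℚ n) 1ℚ (fromℕℚ m) ⟨
  (1ℚ ℚ.+ fromℕℚ m) ℚ.* fromℕℚ n                  ≡⟨ cong (ℚ._* fromℕℚ n) (fromℕℚ-+ 1 m) ⟨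
  fromℕℚ (suc m) ℚ.* fromℕℚ n                     ∎
  where open ≡-Reasoning

fromℕℚ-nonNeg : ∀ m → ℚ.NonNegative (fromℕℚ m)
fromℕℚ-nonNeg m = ℚ.normalize-nonNeg m 1

fromℕℚ-pos : ∀ m .{{_ : ℕ.NonZero m}} → ℚ.Positive (fromℕℚ m)
fromℕℚ-pos m = ℚ.normalize-pos m 1

fromℕℚ-mono-≤ : ∀ {m n} → m ≤ n → fromℕℚ m ℚ.≤ fromℕℚ n
fromℕℚ-mono-≤ {m} {n} m≤n = begin
  fromℕℚ m                            ≡⟨ ℚ.+-identityʳ (fromℕℚ m) ⟨
  fromℕℚ m ℚ.+ 0ℚ                     ≤⟨ ℚ.+-monoʳ-≤ (fromℕℚ m) (ℚ.nonNegative⁻¹ _ {{fromℕℚ-nonNeg (n ∸ m)}}) ⟩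
  fromℕℚ m ℚ.+ fromℕℚ (n ∸ m)         ≡⟨ fromℕℚ-+ m (n ∸ m) ⟨
  fromℕℚ (m ℕ.+ (n ∸ m))              ≡⟨ cong fromℕℚ (ℕ.m+[n∸m]≡n m≤n) ⟩
  fromℕℚ n                            ∎
  where open ℚ.≤-Reasoning

module _ (Δ : ℕ) .{{_ : ℕ.NonZero Δ}} where

  *[1-1/] : fromℕℚ Δ ℚ.* (1ℚ ℚ.- + 1 / Δ) ≡ fromℕℚ (Δ ∸ 1)
  *[1-1/] = begin
    fromℕℚ Δ ℚ.* (1ℚ ℚ.- + 1 / Δ)                      ≡⟨ ℚ.*-comm (fromℕℚ Δ) _ ⟩
    (1ℚ ℚ.- + 1 / Δ) ℚ.* fromℕℚ Δ                      ≡⟨ ℚ.*-distribʳ-+ (fromℕℚ Δ) 1ℚ (ℚ.- (+ 1 / Δ)) ⟩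
    1ℚ ℚ.* fromℕℚ Δ ℚ.+ (ℚ.- (+ 1 / Δ)) ℚ.* fromℕℚ Δ
      ≡⟨ cong₂ ℚ._+_ (ℚ.*-identityˡ (fromℕℚ Δ))
           (trans (sym (ℚ.neg-distribˡ-* (+ 1 / Δ) (fromℕℚ Δ))) (cong ℚ.-_ (/-*-cancel 1 Δ))) ⟩
    fromℕℚ Δ ℚ.- 1ℚ                                    ≡⟨ cong (λ d → fromℕℚ d ℚ.- 1ℚ) (ℕ.m∸n+n≡m (ℕ.>-nonZero⁻¹ Δ)) ⟨
    fromℕℚ (Δ ∸ 1 ℕ.+ 1) ℚ.- 1ℚ                        ≡⟨ cong (ℚ._- 1ℚ) (fromℕℚ-+ (Δ ∸ 1) 1) ⟩
    fromℕℚ (Δ ∸ 1) ℚ.+ 1ℚ ℚ.- 1ℚ                       ≡⟨ ℚ.+-assoc (fromℕℚ (Δ ∸ 1)) 1ℚ (ℚ.- 1ℚ) ⟩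
    fromℕℚ (Δ ∸ 1) ℚ.+ (1ℚ ℚ.- 1ℚ)                     ≡⟨ ℚ.+-identityʳ _ ⟩
    fromℕℚ (Δ ∸ 1)                                     ∎
    where open ≡-Reasoning

  ≤[1-1/]* : ∀ {x y} → Δ ℕ.* x ≤ (Δ ∸ 1) ℕ.* y → fromℕℚ x ℚ.≤ (1ℚ ℚ.- + 1 / Δ) ℚ.* fromℕℚ y
  ≤[1-1/]* {x} {y} Δx≤ = ℚ.*-cancelˡ-≤-pos (fromℕℚ Δ) {{fromℕℚ-pos Δ}} (begin
    fromℕℚ Δ ℚ.* fromℕℚ x                            ≡⟨ fromℕℚ-* Δ x ⟨
    fromℕℚ (Δ ℕ.* x)                                 ≤⟨ fromℕℚ-mono-≤ Δx≤ ⟩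
    fromℕℚ ((Δ ∸ 1) ℕ.* y)                           ≡⟨ fromℕℚ-* (Δ ∸ 1) y ⟩
    fromℕℚ (Δ ∸ 1) ℚ.* fromℕℚ y                      ≡⟨ cong (ℚ._* fromℕℚ y) *[1-1/] ⟨
    fromℕℚ Δ ℚ.* (1ℚ ℚ.- + 1 / Δ) ℚ.* fromℕℚ y       ≡⟨ ℚ.*-assoc (fromℕℚ Δ) _ _ ⟩
    fromℕℚ Δ ℚ.* ((1ℚ ℚ.- + 1 / Δ) ℚ.* fromℕℚ y)     ∎)
    where open ℚ.≤-Reasoning

  -- The factors 1 - 1/Δ and Δ/(Δ - 1) are inverse to each other.
  shrink : .{{_ : ℕ.NonZero (Δ ∸ 1)}} → ∀ {x y z} →
           x ℚ.≤ (1ℚ ℚ.- + 1 / Δ) ℚ.* y → y ℚ.< (+ Δ / (Δ ∸ 1)) ℚ.* z → x ℚ.< z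
  shrink {x} {y} {z} x≤ y< = ℚ.*-cancelˡ-<-nonNeg (fromℕℚ Δ) {{fromℕℚ-nonNeg Δ}} (begin-strict
    fromℕℚ Δ ℚ.* x                                 ≤⟨ ℚ.*-monoˡ-≤-nonNeg (fromℕℚ Δ) {{fromℕℚ-nonNeg Δ}} x≤ ⟩
    fromℕℚ Δ ℚ.* ((1ℚ ℚ.- + 1 / Δ) ℚ.* y)          ≡⟨ ℚ.*-assoc (fromℕℚ Δ) _ y ⟨
    fromℕℚ Δ ℚ.* (1ℚ ℚ.- + 1 / Δ) ℚ.* y            ≡⟨ cong (ℚ._* y) *[1-1/] ⟩
    fromℕℚ (Δ ∸ 1) ℚ.* y                           <⟨ ℚ.*-monoʳ-<-pos (fromℕℚ (Δ ∸ 1)) {{fromℕℚ-pos (Δ ∸ 1)}} y< ⟩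
    fromℕℚ (Δ ∸ 1) ℚ.* ((+ Δ / (Δ ∸ 1)) ℚ.* z)     ≡⟨ ℚ.*-assoc (fromℕℚ (Δ ∸ 1)) _ z ⟨
    fromℕℚ (Δ ∸ 1) ℚ.* (+ Δ / (Δ ∸ 1)) ℚ.* z
      ≡⟨ cong (ℚ._* z) (trans (ℚ.*-comm (fromℕℚ (Δ ∸ 1)) _) (/-*-cancel Δ (Δ ∸ 1))) ⟩
    fromℕℚ Δ ℚ.* z                                 ∎)
    where open ℚ.≤-Reasoning

-- Weights and costs under edge removal

module CutCost {c ℓ₁ ℓ₂} (ℝ : Reals c ℓ₁ ℓ₂) {n} (G : WeightedGraph ℝ n)
               (acyclic : WeightedGraph.Acyclic G) where
  open RealArithmetic ℝ
  open EdgeSums ℝ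
  open WeightedGraph G
  open EdgeRemoval graph acyclic public

  module _ {S A B a b} (split : EdgeSplit S a b A B) where
    open EdgeSplit split

    edgeSum-split : (f : Fin n → Fin n → Carrier) → f a b ≈ f b a →
                    edgeSum ℝ (induced? S) f ≈
                    f a b + (edgeSum ℝ (induced? A) f + edgeSum ℝ (induced? B) f)
    edgeSum-split f fab≈fba = ≈-trans
      (edgeSum-⊎ (induced? S) (sameEdge? a b) parts? edges sameEdge⇒¬parts f)
      (+-cong (edgeSum-sameEdge a≢b f fab≈fba)
        (edgeSum-⊎ parts? (induced? A) (induced? B) (λ x y → mk⇔ (λ r → r) (λ r → r))
          (λ x y ((x∈A , _) , (x∈B , _)) → disjoint x∈A x∈B) f))
      where
      parts? : Decidable (λ x y → Induced A x y ⊎ Induced B x y)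
      parts? x y = induced? A x y ⊎-dec induced? B x y

    W-split : W ℝ G S ≈ w a b + (W ℝ G A + W ℝ G B)
    W-split = edgeSum-split w (w-sym (proj₂ (proj₂ edge)))

    0<w : 0# <ᴿ w a b
    0<w = w-pos (proj₂ (proj₂ edge))

  W-nonneg : ∀ S → 0# ≤ᴿ W ℝ G S
  W-nonneg S = edgeSum-nonneg (induced? S) (λ x y (_ , _ , x~y) → <ᴿ⇒≤ᴿ (w-pos x~y))

  module _ {S A B a b} (split : EdgeSplit S a b A B) where

    W-parts≤ : W ℝ G A + W ℝ G B ≤ᴿ W ℝ G S
    W-parts≤ = begin
      W ℝ G A + W ℝ G B              ≈⟨ +-identityˡ _ ⟨
      0# + (W ℝ G A + W ℝ G B)       ≤⟨ +-mono-≤ᴿ (<ᴿ⇒≤ᴿ (0<w split)) ≤ᴿ-refl ⟩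
      w a b + (W ℝ G A + W ℝ G B)    ≈⟨ W-split split ⟨
      W ℝ G S                        ∎
      where open ≤ᴿ-Reasoning

    W-pos : 0# <ᴿ W ℝ G S
    W-pos = <-≤ᴿ-trans (0<w split) (begin
      w a b                          ≈⟨ +-identityʳ _ ⟨
      w a b + 0#                     ≈⟨ +-congˡ (+-identityʳ 0#) ⟨
      w a b + (0# + 0#)              ≤⟨ +-monoʳ-≤ᴿ _ (+-mono-≤ᴿ (W-nonneg A) (W-nonneg B)) ⟩
      w a b + (W ℝ G A + W ℝ G B)    ≈⟨ W-split split ⟨
      W ℝ G S                        ∎)
      where open ≤ᴿ-Reasoning

  hierarchyCost : ∀ {S} → HierarchyOn S → Carrier
  hierarchyCost {S} H = edgeSum ℝ (induced? S) (λ x y → w x y * fromℕ (HierarchyOn.level H x y))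

  hierarchyCost-singleton : ∀ {S x} (x∈S : x ∈ S) (∣S∣≡1 : ∣ S ∣ ≡ 1) →
                            hierarchyCost (hierarchyOn-singleton x∈S ∣S∣≡1) ≈ 0#
  hierarchyCost-singleton {S} x∈S ∣S∣≡1 = edgeSum-zero (induced? S) λ y z (y∈S , z∈S , y~z) →
    contradiction (distinct⇒2≤∣∣ y∈S z∈S (~⇒≢ y~z)) (ℕ.<⇒≱ (ℕ.≤-reflexive (cong suc ∣S∣≡1)))

  module _ {S A B a b} (split : EdgeSplit S a b A B) (HA : HierarchyOn A) (HB : HierarchyOn B) where
    open EdgeSplit split
    open Join graph acyclic split HA HB

    hierarchyCost-join : hierarchyCost join ≈
                         w a b * fromℕ (∣ S ∣ ∸ 1) + (hierarchyCost HA + hierarchyCost HB)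
    hierarchyCost-join = ≈-trans
      (edgeSum-split split joinCost
        (*-cong (w-sym (proj₂ (proj₂ edge)))
                (fromℕ-cong (trans (level-AB a∈A b∈B) (sym (level-BA b∈B a∈A))))))
      (+-cong (*-congˡ (fromℕ-cong (level-AB a∈A b∈B)))
        (+-cong
          (edgeSum-cong (induced? A) (induced? A) (λ x y → mk⇔ (λ r → r) (λ r → r))
            (λ x y (x∈A , y∈A , _) → *-congˡ (fromℕ-cong (level-A x∈A y∈A))))
          (edgeSum-cong (induced? B) (induced? B) (λ x y → mk⇔ (λ r → r) (λ r → r))
            (λ x y (x∈B , y∈B , _) → *-congˡ (fromℕ-cong (level-B x∈B y∈B))))))
      where
      joinCost : Fin n → Fin n → Carrier
      joinCost x y = w x y * fromℕ (HierarchyOn.level join x y)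

      fromℕ-cong : ∀ {k l} → k ≡ l → fromℕ k ≈ fromℕ l
      fromℕ-cong refl = ≈-refl

-- The hierarchy of recursive cuts

module RecursiveCuts {c ℓ₁ ℓ₂} (ℝ : Reals c ℓ₁ ℓ₂) (Δ : ℕ) (2≤Δ : 2 ≤ Δ) (Λ : Reals.Carrier ℝ)
                     {n : ℕ} (2≤n : 2 ≤ n) (G : WeightedGraph ℝ n) (tree : WeightedGraph.IsTree G)
                     (cheap : HasCheapBalancedEdges ℝ G Δ 2≤Δ Λ) where
  open RealArithmetic ℝ
  open EdgeSums ℝ
  open WeightedGraph G
  open CutCost ℝ G (proj₂ tree)
  open Domination graph (proj₂ tree)
  open Exp (CommutativeRing.semiring ℚ.+-*-commutativeRing) using (_^_)

  private instance
    Δ≢0 : ℕ.NonZero Δ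
    Δ≢0 = 2≤⇒nonZero 2≤Δ

    Δ-1≢0 : ℕ.NonZero (Δ ∸ 1)
    Δ-1≢0 = 2≤⇒pred-nonZero 2≤Δ

  base : ℚ
  base = + Δ / (Δ ∸ 1)

  top-connected : InducedConnected Subset.⊤
  top-connected x y _ _ = Star.map (λ x~y → ∈⊤ , ∈⊤ , x~y) (proj₁ tree x y)

  2≤∣⊤∣ : 2 ≤ ∣ Subset.⊤ {n} ∣
  2≤∣⊤∣ = ℕ.≤-trans 2≤n (ℕ.≤-reflexive (sym (∣⊤∣≡n n)))

  0<W⊤ : 0# <ᴿ W ℝ G Subset.⊤
  0<W⊤ =
    let _ , _ , ab , (_ , _ , isA , isB , _) , _ = cheap Subset.⊤ top-connected 2≤∣⊤∣
    in W-pos (edgeSplit top-connected ab isA isB)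

  -- The cheap edge of the whole tree has positive weight, at most Λ times a
  -- positive number.
  0<Λ : 0# <ᴿ Λ
  0<Λ =
    let _ , _ , (_ , _ , a~b) , _ , w≤ = cheap Subset.⊤ top-connected 2≤∣⊤∣
        m≢0 = 2≤⇒pred-nonZero 2≤∣⊤∣
    in 0<*⇒0<ʳ (*-pos 0<W⊤ (⁻¹-pos (0<fromℕ {{m≢0}}) (fromℕ#0 _ {{m≢0}})))
               (<-SPO.<-respʳ-≈ (*-comm Λ _) (<-≤ᴿ-trans (w-pos a~b) w≤))

  cheap⇒≤ : ∀ {S a b} (m≢0 : ℕ.NonZero (∣ S ∣ ∸ 1)) →
            w a b ≤ᴿ Λ * (_÷ℕ_ (W ℝ G S) (∣ S ∣ ∸ 1) {{m≢0}}) →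
            w a b * fromℕ (∣ S ∣ ∸ 1) ≤ᴿ Λ * W ℝ G S
  cheap⇒≤ {S} {a} {b} m≢0 w≤ = begin
    w a b * M                        ≈⟨ *-comm _ _ ⟩
    M * w a b                        ≤⟨ *-monoˡ-≤ᴿ (0<fromℕ {{m≢0}}) w≤ ⟩
    M * (Λ * (W ℝ G S ÷ M ⟨ M#0 ⟩))  ≈⟨ *-assoc M Λ _ ⟨
    M * Λ * (W ℝ G S ÷ M ⟨ M#0 ⟩)    ≈⟨ *-congʳ (*-comm M Λ) ⟩
    Λ * M * (W ℝ G S ÷ M ⟨ M#0 ⟩)    ≈⟨ *-assoc Λ M _ ⟩
    Λ * (M * (W ℝ G S ÷ M ⟨ M#0 ⟩))  ≈⟨ *-congˡ (*⁻¹-cancel _ M#0) ⟩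
    Λ * W ℝ G S                      ∎
    where
    open ≤ᴿ-Reasoning
    M   = fromℕ (∣ S ∣ ∸ 1)
    M#0 = fromℕ#0 (∣ S ∣ ∸ 1) {{m≢0}}

  record CheapHierarchy (j : ℕ) (S : Subset n) : Set (c ⊔ ℓ₁ ⊔ ℓ₂) where
    field
      hierarchyOn : HierarchyOn S
      dominating  : Dominating hierarchyOn
      cost≤       : hierarchyCost hierarchyOn ≤ᴿ fromℕ j * (Λ * W ℝ G S)

  cheapHierarchy-singleton : ∀ {j S x} → x ∈ S → ∣ S ∣ ≡ 1 → CheapHierarchy j S
  cheapHierarchy-singleton {j} {S} x∈S ∣S∣≡1 = record
    { hierarchyOn = hierarchyOn-singleton x∈S ∣S∣≡1
    ; dominating  = dominating-singleton x∈S ∣S∣≡1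
    ; cost≤       = ≤ᴿ-respˡ-≈ (≈-sym (hierarchyCost-singleton x∈S ∣S∣≡1))
                      (fromℕ*-nonneg j (*-nonneg 0<Λ (W-nonneg S)))
    }

  -- The cut itself costs w(e_S) (|S| - 1) ≤ Λ W(S).  As the parts are disjoint,
  -- W(A) + W(B) ≤ W(S), so each of the j levels below also costs at most Λ W(S).
  cheapHierarchy-join : ∀ {j S A B a b} → EdgeSplit S a b A B →
                        w a b * fromℕ (∣ S ∣ ∸ 1) ≤ᴿ Λ * W ℝ G S →
                        CheapHierarchy j A → CheapHierarchy j B → CheapHierarchy (suc j) S
  cheapHierarchy-join {j} {S} {A} {B} {a} {b} split w≤ CA CB = record
    { hierarchyOn = Join.join graph (proj₂ tree) split CA.hierarchyOn CB.hierarchyOn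
    ; dominating  = dominating-join split {CA.hierarchyOn} {CB.hierarchyOn} CA.dominating CB.dominating
    ; cost≤       = begin
        hierarchyCost (Join.join graph (proj₂ tree) split CA.hierarchyOn CB.hierarchyOn)
          ≈⟨ hierarchyCost-join split CA.hierarchyOn CB.hierarchyOn ⟩
        w a b * fromℕ (∣ S ∣ ∸ 1) + (hierarchyCost CA.hierarchyOn + hierarchyCost CB.hierarchyOn)
          ≤⟨ +-mono-≤ᴿ w≤ (+-mono-≤ᴿ CA.cost≤ CB.cost≤) ⟩
        Λ * W ℝ G S + (fromℕ j * (Λ * W ℝ G A) + fromℕ j * (Λ * W ℝ G B))
          ≈⟨ +-congˡ (distribˡ (fromℕ j) _ _) ⟨
        Λ * W ℝ G S + fromℕ j * (Λ * W ℝ G A + Λ * W ℝ G B)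
          ≈⟨ +-congˡ (*-congˡ (distribˡ Λ _ _)) ⟨
        Λ * W ℝ G S + fromℕ j * (Λ * (W ℝ G A + W ℝ G B))
          ≤⟨ +-monoʳ-≤ᴿ _ (fromℕ*-mono-≤ j (*-monoˡ-≤ᴿ 0<Λ (W-parts≤ split))) ⟩
        Λ * W ℝ G S + fromℕ j * (Λ * W ℝ G S)
          ≈⟨ +-congʳ (*-identityˡ _) ⟨
        1# * (Λ * W ℝ G S) + fromℕ j * (Λ * W ℝ G S)
          ≈⟨ distribʳ _ 1# (fromℕ j) ⟨
        fromℕ (suc j) * (Λ * W ℝ G S) ∎
    }
    where
    open ≤ᴿ-Reasoning
    module CA = CheapHierarchy CA
    module CB = CheapHierarchy CB

  -- Both parts of S have at most (1 - 1/Δ) (|S| - 1) edges, so one factor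
  -- Δ/(Δ - 1) is used up at each level; with none left, S is a single vertex.
  recursiveCut : ∀ j {S x} → InducedConnected S → x ∈ S → fromℕℚ (∣ S ∣ ∸ 1) ℚ.< base ^ j → CheapHierarchy j S
  recursiveCut j {S} connected x∈S small = [ cut j small , singleton ]′ (ℕ.≤-<-connex 2 ∣ S ∣)
    where
    singleton : ∣ S ∣ < 2 → CheapHierarchy j S
    singleton ∣S∣<2 = cheapHierarchy-singleton x∈S (ℕ.≤-antisym (ℕ.s≤s⁻¹ ∣S∣<2) (nonempty⇒1≤∣∣ x∈S))

    cut : ∀ j → fromℕℚ (∣ S ∣ ∸ 1) ℚ.< base ^ j → 2 ≤ ∣ S ∣ → CheapHierarchy j S
    cut zero    small 2≤∣S∣ =
      ⊥-elim (ℚ.<-irrefl refl (ℚ.<-≤-trans small (fromℕℚ-mono-≤ (ℕ.∸-monoˡ-≤ 1 2≤∣S∣))))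
    cut (suc j) small 2≤∣S∣ =
      let a , b , ab , (A , B , isA , isB , balanced) , w≤ = cheap S connected 2≤∣S∣
          split = edgeSplit connected ab isA isB
          open EdgeSplit split
          part-small : ∀ {m} → m ≤ (∣ A ∣ ∸ 1) ℕ.⊔ (∣ B ∣ ∸ 1) → fromℕℚ m ℚ.< base ^ j
          part-small = λ m≤ → shrink Δ (ℚ.≤-trans (fromℕℚ-mono-≤ m≤) balanced) small
      in cheapHierarchy-join split (cheap⇒≤ (2≤⇒pred-nonZero 2≤∣S∣) w≤)
           (recursiveCut j A-connected a∈A (part-small (ℕ.m≤m⊔n (∣ A ∣ ∸ 1) (∣ B ∣ ∸ 1))))
           (recursiveCut j B-connected b∈B (part-small (ℕ.m≤n⊔m (∣ A ∣ ∸ 1) (∣ B ∣ ∸ 1))))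

  ~⇔induced-⊤ : ∀ x y → x ~ y ⇔ Induced Subset.⊤ x y
  ~⇔induced-⊤ x y = mk⇔ (λ x~y → ∈⊤ , ∈⊤ , x~y) (proj₂ ∘ proj₂)

  -- Adjacent vertices are at distance 1, so every feasible u is at least 1 on
  -- each edge.
  W⊤≤optFree : ∀ {optFree} → IsOPTfree ℝ G optFree → W ℝ G Subset.⊤ ≤ᴿ optFree
  W⊤≤optFree {optFree} ((u , (_ , u≥d) , cost≈) , _) = begin
    W ℝ G Subset.⊤            ≈⟨ edgeSum-cong _~?_ (induced? Subset.⊤) ~⇔induced-⊤ (λ _ _ _ → ≈-refl) ⟨
    edgeSum ℝ _~?_ w          ≤⟨ edgeSum-mono-≤ _~?_ w≤wu ⟩
    cost ℝ G u                ≈⟨ cost≈ ⟩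
    optFree                   ∎
    where
    open ≤ᴿ-Reasoning

    distance-1 : ∀ {x y} → x ~ y → IsDistance x y 1
    distance-1 x~y = (x~y ◅ ε , refl) , λ { ε → contradiction x~y ~-irrefl ; (_ ◅ _) → s≤s z≤n }

    w≤wu : ∀ x y → x ~ y → w x y ≤ᴿ w x y * u x y
    w≤wu x y x~y = begin
      w x y            ≈⟨ *-identityʳ _ ⟨
      w x y * 1#       ≈⟨ *-congˡ (+-identityʳ 1#) ⟨
      w x y * fromℕ 1  ≤⟨ *-monoˡ-≤ᴿ (w-pos x~y) (u≥d x y 1 (distance-1 x~y)) ⟩
      w x y * u x y    ∎

  optCard≤ : ∀ {optCard j} → IsOPTcard ℝ G optCard → CheapHierarchy j Subset.⊤ →
             optCard ≤ᴿ fromℕ j * (Λ * W ℝ G Subset.⊤)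
  optCard≤ {optCard} {j} (_ , least) C = begin
    optCard               ≤⟨ least (HierarchyOn.tree hierarchyOn) (hierarchy hierarchyOn , above-distance) ⟩
    cost ℝ G (λ x y → fromℕ (HierarchyOn.level hierarchyOn x y))
      ≈⟨ edgeSum-cong _~?_ (induced? Subset.⊤) ~⇔induced-⊤ (λ _ _ _ → ≈-refl) ⟩
    hierarchyCost hierarchyOn       ≤⟨ cost≤ ⟩
    fromℕ j * (Λ * W ℝ G Subset.⊤)  ∎
    where
    open ≤ᴿ-Reasoning
    open CheapHierarchy C

    above-distance : ∀ x y d → IsDistance x y d → d ≤ HierarchyOn.level hierarchyOn x y
    above-distance x y d (_ , shortest) =
      let p , p≤ = dominating ∈⊤ ∈⊤ in ℕ.≤-trans (shortest p) p≤

  cheapHierarchy : ∀ k → IsFloorLog base (fromℕℚ (n ∸ 1)) k → CheapHierarchy (suc k) Subset.⊤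
  cheapHierarchy k (_ , n-1<) = recursiveCut (suc k) top-connected (∈⊤ {x = Fin.fromℕ< 2≤n})
    (subst (λ m → fromℕℚ (m ∸ 1) ℚ.< base ^ suc k) (sym (∣⊤∣≡n n)) n-1<)

  ratioBound : RatioBound ℝ G Δ 2≤Δ Λ
  ratioBound optCard optFree k isCard isFree isLog = inj₂ 0<optFree , ≤*⇒÷≤ 0<optFree (inj₂ 0<optFree) (begin
    optCard                                   ≤⟨ optCard≤ isCard (cheapHierarchy k isLog) ⟩
    fromℕ (suc k) * (Λ * W ℝ G Subset.⊤)      ≈⟨ *-assoc _ Λ _ ⟨
    fromℕ (suc k) * Λ * W ℝ G Subset.⊤        ≈⟨ *-congʳ (*-comm _ Λ) ⟩
    Λ * fromℕ (suc k) * W ℝ G Subset.⊤        ≤⟨ *-monoˡ-≤ᴿ (*-pos 0<Λ (fromℕ-suc-pos k)) (W⊤≤optFree isFree) ⟩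
    Λ * fromℕ (suc k) * optFree               ≈⟨ *-comm _ optFree ⟩
    optFree * (Λ * fromℕ (suc k))             ∎)
    where
    open ≤ᴿ-Reasoning

    0<optFree : 0# <ᴿ optFree
    0<optFree = <-≤ᴿ-trans 0<W⊤ (W⊤≤optFree isFree)

-- Balanced edges in trees of bounded degree

1≤∣∣⇒nonempty : ∀ {n} {S : Subset n} → 1 ≤ ∣ S ∣ → Nonempty S
1≤∣∣⇒nonempty {n} {S} 1≤∣S∣ with nonempty? S
... | yes nonempty = nonempty
... | no empty rewrite Empty-unique empty | ∣⊥∣≡0 n = contradiction 1≤∣S∣ λ ()

module _ {n : ℕ} {P : Fin n → Set} (P? : ∀ x → Dec (P x)) where
  ⟦_⟧ : Subset n
  ⟦_⟧ = tabulate (λ x → does (P? x))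

  ∈⟦⟧⁺ : ∀ {x} → P x → x ∈ ⟦_⟧
  ∈⟦⟧⁺ {x} Px = lookup⇒[]= x ⟦_⟧ (trans (lookup∘tabulate (λ x → does (P? x)) x) (dec-true (P? x) Px))

  ∈⟦⟧⁻ : ∀ {x} → x ∈ ⟦_⟧ → P x
  ∈⟦⟧⁻ {x} x∈ with P? x | trans (sym (lookup∘tabulate (λ x → does (P? x)) x)) ([]=⇒lookup x∈)
  ... | yes Px | _ = Px

module BalancedEdge {n} (G : Graph n) (acyclic : Graph.Acyclic G) (Δ : ℕ) .{{_ : ℕ.NonZero Δ}}
                    (degree≤Δ : ∀ x → Graph.degree G x ≤ Δ)
                    {S : Subset n} (connected : Graph.InducedConnected G S) (2≤∣S∣ : 2 ≤ ∣ S ∣) where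
  open Graph G
  open EdgeRemoval G acyclic

  cut? : ∀ a b → Decidable (RemoveEdge (Induced S) a b)
  cut? a b x y = induced? S x y ×-dec ¬? (sameEdge? a b x y)

  abstract
    branch : (v c : Fin n) → Subset n
    branch v c = proj₁ (component (cut? v c) c)

    branch-component : ∀ v c → IsComponentOf (RemoveEdge (Induced S) v c) c (branch v c)
    branch-component v c = proj₂ (component (cut? v c) c)

  -- The balance condition for the other side of the edge vc: that side has
  -- |S| - 1 - |branch v c| edges, and this is at most (1 - 1/Δ) (|S| - 1)
  -- precisely when Δ |branch v c| is at least |S| - 1.
  Heavy : (v c : Fin n) → Set
  Heavy v c = ∣ S ∣ ∸ 1 ≤ Δ ℕ.* ∣ branch v c ∣

  Avoiding : Fin n → Rel (Fin n) 0ℓ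
  Avoiding v x y = Induced S x y × x ≢ v × y ≢ v

  avoiding⇒cut : ∀ {v c x y} → Avoiding v x y → RemoveEdge (Induced S) v c x y
  avoiding⇒cut (xy , x≢v , y≢v) = xy , [ x≢v ∘ proj₁ , y≢v ∘ proj₂ ]′

  -- A walk that starts at v is thus replaced by an edge at v and a walk avoiding v,
  -- which remains available when that edge is removed.
  lastExit : ∀ {v x y} → x ≢ v → Star (Induced S) y x →
             Star (Avoiding v) y x ⊎ ∃ λ c → Induced S v c × Star (Avoiding v) c x
  lastExit x≢v ε = inj₁ ε
  lastExit {v} x≢v (_◅_ {i = y} {j = y′} yy′ path) with lastExit x≢v path | y ≟ v | y′ ≟ v
  ... | inj₂ exit  | _        | _        = inj₂ exit
  ... | inj₁ path′ | yes refl | _        = inj₂ (y′ , yy′ , path′)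
  ... | inj₁ path′ | no y≢v   | no y′≢v  = inj₁ ((yy′ , y≢v , y′≢v) ◅ path′)
  ... | inj₁ ε     | no y≢v   | yes refl = contradiction refl x≢v
  ... | inj₁ ((_ , y′≢v , _) ◅ _) | no _ | yes y′≡v = contradiction y′≡v y′≢v

  in-branch : ∀ {v x} → v ∈ S → x ∈ S → x ≢ v → ∃ λ c → Induced S v c × x ∈ branch v c
  in-branch {v} {x} v∈S x∈S x≢v with lastExit x≢v (connected v x v∈S x∈S)
  ... | inj₁ ε                     = contradiction refl x≢v
  ... | inj₁ ((_ , v≢v , _) ◅ _)   = contradiction refl v≢v
  ... | inj₂ (c , vc , path)       = c , vc , Equivalence.from (branch-component v c x) (Star.map avoiding⇒cut path)

  degree-in-S : ∀ v → ∣ ⟦ induced? S v ⟧ ∣ ≤ Δ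
  degree-in-S v = ℕ.≤-trans
    (p⊆q⇒∣p∣≤∣q∣ (λ x∈ → ∈⟦⟧⁺ (v ~?_) (proj₂ (proj₂ (∈⟦⟧⁻ (induced? S v) x∈))))) (degree≤Δ v)

  -- The branches at v are at most Δ sets covering the |S| - 1 vertices other
  -- than v; if each were light, that is Δ times its size at most |S| - 2, they
  -- would cover at most |S| - 2 vertices.
  heavyBranch : ∀ {v} → v ∈ S → ∃ λ c → Induced S v c × Heavy v c
  heavyBranch {v} v∈S
    with any? (λ c → induced? S v c ×-dec ∣ S ∣ ∸ 1 ℕ.≤? Δ ℕ.* ∣ branch v c ∣)
  ... | yes heavy = heavy
  ... | no ¬heavy = ⊥-elim (ℕ.<-irrefl refl (begin-strict
      ∣ S ∣ ∸ 1                ≤⟨ ℕ.∸-monoˡ-≤ 1 (∣∣-subadditive S ⁅ v ⁆ (S Subset.- v) split) ⟩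
      ∣ ⁅ v ⁆ ∣ ℕ.+ ∣ S Subset.- v ∣ ∸ 1  ≡⟨ cong (λ k → k ℕ.+ ∣ S Subset.- v ∣ ∸ 1) (∣⁅x⁆∣≡1 v) ⟩
      ∣ S Subset.- v ∣         ≤⟨ ℕ.*-cancelˡ-≤ Δ (ℕ.≤-trans light (ℕ.*-monoˡ-≤ _ (degree-in-S v))) ⟩
      ℕ.pred (∣ S ∣ ∸ 1)       <⟨ ℕ.n<1+n _ ⟩
      suc (ℕ.pred (∣ S ∣ ∸ 1)) ≡⟨ ℕ.suc-pred (∣ S ∣ ∸ 1) {{2≤⇒pred-nonZero 2≤∣S∣}} ⟩
      ∣ S ∣ ∸ 1                ∎))
    where
    open ℕ.≤-Reasoning

    split : ∀ {x} → x ∈ S → x ∈ ⁅ v ⁆ ⊎ x ∈ S Subset.- v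
    split {x} x∈S with x ≟ v
    ... | yes refl = inj₁ (x∈⁅x⁆ v)
    ... | no x≢v   = inj₂ (x∈p∧x≢y⇒x∈p-y x∈S x≢v)

    cover : ∀ {x} → x ∈ S Subset.- v → ∃ λ c → c ∈ ⟦ induced? S v ⟧ × x ∈ branch v c
    cover x∈S-v with in-branch v∈S (p─q⊆p S ⁅ v ⁆ x∈S-v) (λ { refl → x∈p─q⇒x∉q S ⁅ v ⁆ x∈S-v (x∈⁅x⁆ v) })
    ... | c , vc , x∈branch = c , ∈⟦⟧⁺ (induced? S v) vc , x∈branch

    light : Δ ℕ.* ∣ S Subset.- v ∣ ≤ ∣ ⟦ induced? S v ⟧ ∣ ℕ.* ℕ.pred (∣ S ∣ ∸ 1)
    light = ∣∣-cover ⟦ induced? S v ⟧ (S Subset.- v) (branch v) Δ cover λ {c} c∈ →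
      ℕ.<⇒≤pred (ℕ.≰⇒> λ heavy → ¬heavy (c , ∈⟦⟧⁻ (induced? S v) c∈ , heavy))

  c∉branch : ∀ {c d} → Induced S c d → c ∉ branch c d
  c∉branch cd c∈ = cut-separates cd
    (reverse (removeEdge-sym induced-sym) (Equivalence.to (branch-component _ _ _) c∈))

  -- The branch at c towards d never passes through c, so it does not use the
  -- edge vc either.
  branch⊂ : ∀ {v c d} → Induced S c d → d ≢ v → branch c d ⊂ branch v c
  branch⊂ {v} {c} {d} cd d≢v = (λ {x} x∈ → transfer d∈ ε (Equivalence.to (branch-component c d x) x∈)) ,
                               c , c∈ , c∉branch cd
    where
    c∈ : c ∈ branch v c
    c∈ = Equivalence.from (branch-component v c c) ε

    extend : ∀ {x y} → x ∈ branch v c → RemoveEdge (Induced S) v c x y → y ∈ branch v c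
    extend x∈ xy = component-step (isComponentOf-swap (branch-component v c)) x∈ (removeEdge-swap {R = Induced S} xy)

    d∈ : d ∈ branch v c
    d∈ = extend c∈ (cd , [ (λ (c≡v , d≡c) → ~⇒≢ (proj₂ (proj₂ cd)) (sym d≡c)) , d≢v ∘ proj₂ ]′)

    ≢c : ∀ {x} → Star (RemoveEdge (Induced S) c d) d x → x ≢ c
    ≢c path refl = c∉branch cd (Equivalence.from (branch-component c d c) path)

    transfer : ∀ {x y} → x ∈ branch v c → Star (RemoveEdge (Induced S) c d) d x →
               Star (RemoveEdge (Induced S) c d) x y → y ∈ branch v c
    transfer x∈ before ε = x∈
    transfer x∈ before (xx′ ◅ after) = transfer
      (extend x∈ (proj₁ xx′ , [ ≢c (before ◅◅ (xx′ ◅ ε)) ∘ proj₂ , ≢c before ∘ proj₁ ]′))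
      (before ◅◅ (xx′ ◅ ε)) after

  -- If the side of v is light, then the heavy branch at c is not the one back
  -- to v, hence lies inside the branch from v to c.
  descend : ∀ {v c} → Induced S v c → Heavy v c → Acc _<_ ∣ branch v c ∣ →
            ∃₂ λ a b → Induced S a b × Heavy a b × Heavy b a
  descend {v} {c} vc heavy (acc smaller) with ∣ S ∣ ∸ 1 ℕ.≤? Δ ℕ.* ∣ branch c v ∣
  ... | yes heavy-back = v , c , vc , heavy , heavy-back
  ... | no ¬heavy-back with heavyBranch (proj₁ (proj₂ vc))
  ...   | d , cd , heavy-cd = descend cd heavy-cd
            (smaller (p⊂q⇒∣p∣<∣q∣ (branch⊂ cd (λ { refl → ¬heavy-back heavy-cd }))))

  record BalancedCut : Set where
    field
      {a b}     : Fin n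
      {A B}     : Subset n
      edge      : Induced S a b
      componentA : IsComponentOf (RemoveEdge (Induced S) a b) a A
      componentB : IsComponentOf (RemoveEdge (Induced S) a b) b B
      A-heavy    : ∣ S ∣ ∸ 1 ≤ Δ ℕ.* ∣ A ∣
      B-heavy    : ∣ S ∣ ∸ 1 ≤ Δ ℕ.* ∣ B ∣

    split : EdgeSplit S a b A B
    split = edgeSplit connected edge componentA componentB

    open EdgeSplit split

    -- |S| - 1 = (|A| - 1) + |B|, so heaviness of B bounds |A| - 1, and vice versa.
    balancedSplit : BalancedSplit Δ S A B
    balancedSplit = ≤[1-1/]* Δ (begin
      Δ ℕ.* ((∣ A ∣ ∸ 1) ℕ.⊔ (∣ B ∣ ∸ 1))              ≡⟨ ℕ.*-distribˡ-⊔ Δ _ _ ⟩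
      (Δ ℕ.* (∣ A ∣ ∸ 1)) ℕ.⊔ (Δ ℕ.* (∣ B ∣ ∸ 1))      ≤⟨ ℕ.⊔-lub
        (light-rest B-heavy (trans ∣S∣∸1≡ (trans (sym (ℕ.+-suc _ _)) (cong ((∣ A ∣ ∸ 1) ℕ.+_) (suc[∸1] b∈B)))))
        (light-rest A-heavy (trans ∣S∣∸1≡ (trans (cong (ℕ._+ (∣ B ∣ ∸ 1)) (suc[∸1] a∈A)) (ℕ.+-comm ∣ A ∣ _)))) ⟩
      (Δ ∸ 1) ℕ.* (∣ S ∣ ∸ 1)                          ∎)
      where
      open ℕ.≤-Reasoning

      suc[∸1] : ∀ {x C} → x ∈ C → suc (∣ C ∣ ∸ 1) ≡ ∣ C ∣
      suc[∸1] x∈C = ℕ.m+[n∸m]≡n (nonempty⇒1≤∣∣ x∈C)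

      light-rest : ∀ {m p q} → m ≤ Δ ℕ.* q → m ≡ p ℕ.+ q → Δ ℕ.* p ≤ (Δ ∸ 1) ℕ.* m
      light-rest {m} {p} {q} m≤Δq m≡p+q = ℕ.+-cancelˡ-≤ m _ _ (begin
        m ℕ.+ Δ ℕ.* p              ≤⟨ ℕ.+-monoˡ-≤ _ m≤Δq ⟩
        Δ ℕ.* q ℕ.+ Δ ℕ.* p        ≡⟨ ℕ.*-distribˡ-+ Δ q p ⟨
        Δ ℕ.* (q ℕ.+ p)            ≡⟨ cong (Δ ℕ.*_) (trans (ℕ.+-comm q p) (sym m≡p+q)) ⟩
        Δ ℕ.* m                    ≡⟨ cong (ℕ._* m) (ℕ.suc-pred Δ) ⟨
        m ℕ.+ (Δ ∸ 1) ℕ.* m        ∎)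

  balancedCut : BalancedCut
  balancedCut =
    let v , v∈S = 1≤∣∣⇒nonempty (ℕ.≤-trans (s≤s z≤n) 2≤∣S∣)
        c , vc , heavy-vc = heavyBranch v∈S
        a , b , ab , heavy-ab , heavy-ba = descend vc heavy-vc (<-wellFounded _)
    in record
      { edge       = ab
      ; componentA = isComponentOf-swap (branch-component b a)
      ; componentB = branch-component a b
      ; A-heavy    = heavy-ba
      ; B-heavy    = heavy-ab
      }

-- Bounded weight ratio

module WeightRatio {c ℓ₁ ℓ₂} (ℝ : Reals c ℓ₁ ℓ₂) (Δ : ℕ) (2≤Δ : 2 ≤ Δ) (Λ : Reals.Carrier ℝ)
                   {n : ℕ} (G : WeightedGraph ℝ n) (tree : WeightedGraph.IsTree G)
                   (degree≤Δ : ∀ x → WeightedGraph.degree G x ≤ Δ) where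
  open RealArithmetic ℝ
  open WeightedGraph G
  open CutCost ℝ G (proj₂ tree)

  private
    instance
      Δ≢0 : ℕ.NonZero Δ
      Δ≢0 = 2≤⇒nonZero 2≤Δ

    module Balanced = BalancedEdge graph (proj₂ tree) Δ degree≤Δ

  module _ {minW} (isMin : IsMinWeight ℝ G minW) where

    minW≤ : ∀ {x y} → x ~ y → minW ≤ᴿ w x y
    minW≤ {x} {y} = proj₂ isMin (x , y)

    0<minW : 0# <ᴿ minW
    0<minW = let _ , x~y , w≈minW = proj₁ isMin in <-SPO.<-respʳ-≈ w≈minW (w-pos x~y)

    -- A connected set S spans at least |S| - 1 edges, by induction along edge
    -- removals.
    minW*≤W : ∀ {S x} → InducedConnected S → x ∈ S → Acc _<_ ∣ S ∣ → minW * fromℕ (∣ S ∣ ∸ 1) ≤ᴿ W ℝ G S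
    minW*≤W {S} connected x∈S (acc smaller) = [ cut , singleton ]′ (ℕ.≤-<-connex 2 ∣ S ∣)
      where
      open ≤ᴿ-Reasoning

      singleton : ∣ S ∣ < 2 → minW * fromℕ (∣ S ∣ ∸ 1) ≤ᴿ W ℝ G S
      singleton ∣S∣<2 rewrite ℕ.≤-antisym (ℕ.s≤s⁻¹ ∣S∣<2) (nonempty⇒1≤∣∣ x∈S) =
        ≤ᴿ-respˡ-≈ (≈-sym (zeroʳ minW)) (W-nonneg S)

      cut : 2 ≤ ∣ S ∣ → minW * fromℕ (∣ S ∣ ∸ 1) ≤ᴿ W ℝ G S
      cut 2≤∣S∣ = begin
        minW * fromℕ (∣ S ∣ ∸ 1)                  ≡⟨ cong (λ k → minW * fromℕ k) ∣S∣∸1≡ ⟩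
        minW * (1# + fromℕ (p ℕ.+ q))             ≈⟨ *-congˡ (+-congˡ (×-homo-+ 1# p q)) ⟩
        minW * (1# + (fromℕ p + fromℕ q))         ≈⟨ distribˡ minW 1# _ ⟩
        minW * 1# + minW * (fromℕ p + fromℕ q)    ≈⟨ +-cong (*-identityʳ minW) (distribˡ minW _ _) ⟩
        minW + (minW * fromℕ p + minW * fromℕ q)
          ≤⟨ +-mono-≤ᴿ (minW≤ (proj₂ (proj₂ edge)))
               (+-mono-≤ᴿ (minW*≤W A-connected a∈A (smaller ∣A∣<∣S∣)) (minW*≤W B-connected b∈B (smaller ∣B∣<∣S∣))) ⟩
        w a b + (W ℝ G A + W ℝ G B)               ≈⟨ W-split split ⟨
        W ℝ G S                                   ∎
        where
        open Balanced.BalancedCut connected 2≤∣S∣ (Balanced.balancedCut connected 2≤∣S∣) using (a; b; A; B; split)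
        open EdgeSplit split
        p = ∣ A ∣ ∸ 1
        q = ∣ B ∣ ∸ 1

    cheapBalancedEdges : ∀ {maxW} → IsMaxWeight ℝ G maxW → QuotientAtMost maxW minW Λ →
                         HasCheapBalancedEdges ℝ G Δ 2≤Δ Λ
    cheapBalancedEdges {maxW} isMax (minW#0 , ratio≤Λ) S connected 2≤∣S∣ =
      a , b , edge , (A , B , componentA , componentB , balancedSplit) , (begin
        w a b       ≤⟨ proj₂ isMax (a , b) a~b ⟩
        maxW        ≤⟨ maxW≤ ⟩
        minW * Λ    ≈⟨ *-comm minW Λ ⟩
        Λ * minW    ≤⟨ *-monoˡ-≤ᴿ 0<Λ (*≤⇒≤÷ 0<M M#0 (≤ᴿ-respˡ-≈ (*-comm minW M) minWM≤W)) ⟩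
        Λ * (W ℝ G S ÷ M ⟨ M#0 ⟩) ∎)
      where
      open ≤ᴿ-Reasoning
      open Balanced.BalancedCut connected 2≤∣S∣ (Balanced.balancedCut connected 2≤∣S∣)
      m≢0 = 2≤⇒pred-nonZero 2≤∣S∣
      M   = fromℕ (∣ S ∣ ∸ 1)
      M#0 = fromℕ#0 (∣ S ∣ ∸ 1) {{m≢0}}

      a~b : a ~ b
      a~b = proj₂ (proj₂ edge)

      maxW≤ : maxW ≤ᴿ minW * Λ
      maxW≤ = ÷≤⇒≤* 0<minW minW#0 ratio≤Λ

      0<Λ : 0# <ᴿ Λ
      0<Λ = 0<*⇒0<ʳ 0<minW (<-≤ᴿ-trans (w-pos a~b) (≤ᴿ-trans (proj₂ isMax (a , b) a~b) maxW≤))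

      0<M : 0# <ᴿ M
      0<M = 0<fromℕ {{m≢0}}

      minWM≤W : minW * M ≤ᴿ W ℝ G S
      minWM≤W = minW*≤W connected (proj₁ edge) (<-wellFounded ∣ S ∣)

-- The ratio bound

corollary12 : ∀ {c ℓ₁ ℓ₂} (ℝ : Reals c ℓ₁ ℓ₂)
    (Δ : ℕ) (2≤Δ : 2 ≤ Δ) (Λ : Reals.Carrier ℝ)
    (n : ℕ) → 2 ≤ n →
    (G : WeightedGraph ℝ n) →
    WeightedGraph.IsTree G →
    (∀ x → WeightedGraph.degree G x ≤ Δ) →
    (HasCheapBalancedEdges ℝ G Δ 2≤Δ Λ → RatioBound ℝ G Δ 2≤Δ Λ)
    ×
    (∀ maxW minW → IsMaxWeight ℝ G maxW → IsMinWeight ℝ G minW →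
    Reals.QuotientAtMost ℝ maxW minW Λ →
    RatioBound ℝ G Δ 2≤Δ Λ)
corollary12 ℝ Δ 2≤Δ Λ n 2≤n G tree degree≤Δ =
  RecursiveCuts.ratioBound ℝ Δ 2≤Δ Λ 2≤n G tree ,
  λ maxW minW isMax isMin ratio≤Λ → RecursiveCuts.ratioBound ℝ Δ 2≤Δ Λ 2≤n G tree
    (WeightRatio.cheapBalancedEdges ℝ Δ 2≤Δ Λ G tree degree≤Δ isMin isMax ratio≤Λ)
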